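{- There is a function $\varepsilon:\mathbb{N}\to\mathbb{R}$ with $\varepsilon(s)\to 0$ as $s\to\infty$ such that for every $n$ and every total Boolean function $f:\{0,1\}^n\to\{0,1\}$, $$bs(f)\le C(f)\le\left(\tfrac{8}{9}+\varepsilon(s(f))\right)s(f)\,2^{s(f)-1}.$$
   Context: For $x\in\{0,1\}^n$ and $B\subseteq[n]$, $x^B$ denotes $x$ with all bits $x_j$, $j\in B$, flipped, and $x^i=x^{\{i\}}$. Sensitivity: $s(f,x)=|\{i\in[n]: f(x)\ne f(x^i)\}|$ and $s(f)=\max_x s(f,x)$. Block sensitivity: $bs(f,x)$ is the maximum number $r$ of pairwise disjoint subsets $B_1,\dots,B_r\subseteq[n]$ with $f(x)\neq f(x^{B_j})$ for all $j\in[r]$; $bs(f)=\max_x bs(f,x)$. Certificate complexity: a partial assignment is a map $p:[n]\to\{0,1,\ast\}$; its support is $\{i:p(i)\ne\ast\}$ and its co-dimension is the size of the support. An input $x$ is consistent with $p$ if $x_i=p(i)$ for all $i$ in the support. $p$ is a $b$-certificate ($b\in\{0,1\}$) if $f(x)=b$ for every $x$ consistent with $p$. $C(f,x)$ is the minimum co-dimension of an $f(x)$-certificate with which $x$ is consistent, and $C(f)=\max_x C(f,x)$. -}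

module Defs where

open import Data.Bool using (Bool; true; false; _xor_; _≟_)
open import Data.Bool.Properties using (xor-identityʳ)
open import Data.Fin using (Fin; zero; suc)
import Data.Fin.Properties as Fin
open import Data.Fin.Subset using (Subset; ⊥; ⁅_⁆; _∈_; _∩_; ∣_∣; Nonempty; Empty)
open import Data.Fin.Subset.Properties
  using (_∈?_; nonempty?; Empty-unique; x∈p∩q⁺)
open import Data.Maybe using (Maybe; just; nothing; is-just)
open import Data.Maybe.Properties using (≡-dec; just-injective)
open import Data.Nat using (ℕ; zero; suc; _≤_; _⊔_; z≤n; s≤s)
open import Data.Nat.Properties using (≤∧≢⇒<; ≤-pred)
import Data.Nat as ℕ
open import Data.Integer using (+_)
open import Data.Rational using (ℚ; 0ℚ; _/_)
import Data.Rational as ℚ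
open import Data.Product using (∃; _×_; _,_; proj₁; proj₂)
open import Data.Vec using (Vec; []; _∷_; lookup; map; zipWith; count; allFin; here; there)
open import Data.Vec.Properties using (lookup-map)
open import Function using (_∘_)
open import Relation.Binary.PropositionalEquality
  using (_≡_; _≢_; refl; sym; trans; cong; cong₂; subst)
open import Relation.Nullary using (Dec; yes; no; contradiction)
open import Relation.Nullary.Decidable
  using (map′; ¬?; _×-dec_; _→-dec_; decidable-stable)
open import Relation.Unary using (Decidable)

------------------------------------------------------------------------
-- Maxima and minima

record IsMaximum (P : ℕ → Set) (m : ℕ) : Set where
  field
    attained : P m
    bound    : ∀ {k} → P k → k ≤ m

record IsMinimum (P : ℕ → Set) (m : ℕ) : Set where
  field
    attained : P m
    bound    : ∀ {k} → P k → m ≤ k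

maximum : ∀ {P : ℕ → Set} → Decidable P → P 0 →
          ∀ N → (∀ {k} → P k → k ≤ N) → ∃ (IsMaximum P)
maximum P? p₀ zero    ub = 0 , record { attained = p₀ ; bound = ub }
maximum {P} P? p₀ (suc N) ub with P? (suc N)
... | yes p = suc N , record { attained = p ; bound = ub }
... | no ¬p = maximum P? p₀ N λ q →
  ≤-pred (≤∧≢⇒< (ub q) λ eq → ¬p (subst P eq q))

minimum : ∀ {P : ℕ → Set} → Decidable P → ∀ N → P N → ∃ (IsMinimum P)
minimum P? zero p = 0 , record { attained = p ; bound = λ _ → z≤n }
minimum {P} P? (suc N) p with P? 0
... | yes p₀ = 0 , record { attained = p₀ ; bound = λ _ → z≤n }
... | no ¬p₀ with minimum (P? ∘ suc) N p
...   | m , isMin = suc m , record { attained = attained ; bound = bound′ }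
  where
  open IsMinimum isMin
  bound′ : ∀ {k} → P k → suc m ≤ k
  bound′ {zero}  q = contradiction q ¬p₀
  bound′ {suc _} q = s≤s (bound q)

------------------------------------------------------------------------
-- Decidable quantification over finite types

Searchable : Set → Set₁
Searchable A = ∀ {P : A → Set} → Decidable P → Dec (∃ P)

bool-search : Searchable Bool
bool-search P? with P? true | P? false
... | yes p | _     = yes (true , p)
... | no _  | yes p = yes (false , p)
... | no ¬p | no ¬q = no λ { (true , p) → ¬p p ; (false , q) → ¬q q }

maybe-search : ∀ {A} → Searchable A → Searchable (Maybe A)
maybe-search A-search P? with P? nothing | A-search (P? ∘ just)
... | yes p | _           = yes (nothing , p)
... | no _  | yes (a , p) = yes (just a , p)
... | no ¬p | no ¬q       = no λ { (nothing , p) → ¬p p ; (just a , q) → ¬q (a , q) }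

vec-search : ∀ {A} → Searchable A → ∀ {n} → Searchable (Vec A n)
vec-search A-search {zero} P? =
  map′ (λ p → [] , p) (λ { ([] , p) → p }) (P? [])
vec-search A-search {suc n} P? =
  map′ (λ { (a , v , p) → a ∷ v , p }) (λ { (a ∷ v , p) → a , v , p })
       (A-search λ a → vec-search A-search λ v → P? (a ∷ v))

searchable-all? : ∀ {A} → Searchable A →
                  ∀ {P : A → Set} → Decidable P → Dec (∀ a → P a)
searchable-all? A-search P? =
  map′ (λ ¬∃¬ a → decidable-stable (P? a) λ ¬p → ¬∃¬ (a , ¬p))
       (λ { ∀p (a , ¬p) → ¬p (∀p a) })
       (¬? (A-search (¬? ∘ P?)))

------------------------------------------------------------------------
-- Boolean functions

Input : ℕ → Set
Input n = Vec Bool n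

BooleanFunction : ℕ → Set
BooleanFunction n = Input n → Bool

infixl 8 _^_

-- A subset is its characteristic vector, so flipping the bits in B is a
-- bitwise exclusive or.
_^_ : ∀ {n} → Input n → Subset n → Input n
x ^ B = zipWith _xor_ x B

max-over-inputs : ∀ {n} → (Input n → ℕ) → ℕ
max-over-inputs {zero}  g = g []
max-over-inputs {suc n} g =
  max-over-inputs (g ∘ (false ∷_)) ⊔ max-over-inputs (g ∘ (true ∷_))

------------------------------------------------------------------------
-- Sensitivity

s-at : ∀ {n} → BooleanFunction n → Input n → ℕ
s-at {n} f x = count (λ i → ¬? (f x ≟ f (x ^ ⁅ i ⁆))) (allFin n)

s : ∀ {n} → BooleanFunction n → ℕ
s f = max-over-inputs (s-at f)

------------------------------------------------------------------------
-- Block sensitivity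

PairwiseDisjoint : ∀ {n r} → Vec (Subset n) r → Set
PairwiseDisjoint B = ∀ i j → i ≢ j → Empty (lookup B i ∩ lookup B j)

AllSensitive : ∀ {n r} → BooleanFunction n → Input n → Vec (Subset n) r → Set
AllSensitive f x B = ∀ j → f x ≢ f (x ^ lookup B j)

HasDisjointSensitiveBlocks : ∀ {n} → BooleanFunction n → Input n → ℕ → Set
HasDisjointSensitiveBlocks {n} f x r =
  ∃ λ (B : Vec (Subset n) r) → PairwiseDisjoint B × AllSensitive f x B

hasDisjointSensitiveBlocks? : ∀ {n} (f : BooleanFunction n) x →
                              Decidable (HasDisjointSensitiveBlocks f x)
hasDisjointSensitiveBlocks? f x r = vec-search (vec-search bool-search) λ B →
  (Fin.all? λ i → Fin.all? λ j →
    ¬? (i Fin.≟ j) →-dec ¬? (nonempty? (lookup B i ∩ lookup B j)))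
  ×-dec
  (Fin.all? λ j → ¬? (f x ≟ f (x ^ lookup B j)))

^-⊥ : ∀ {n} (x : Input n) → x ^ ⊥ ≡ x
^-⊥ []      = refl
^-⊥ (b ∷ x) = cong₂ _∷_ (xor-identityʳ b) (^-⊥ x)

sensitive⇒nonempty : ∀ {n} (f : BooleanFunction n) x B →
                     f x ≢ f (x ^ B) → Nonempty B
sensitive⇒nonempty f x B sens = decidable-stable (nonempty? B) λ empty →
  sens (cong f (sym (trans (cong (x ^_) (Empty-unique empty)) (^-⊥ x))))

#blocks≤n : ∀ {n} (f : BooleanFunction n) x {r} →
            HasDisjointSensitiveBlocks f x r → r ≤ n
#blocks≤n {n} f x {r} (B , disjoint , sens) =
  Fin.injective⇒≤ {f = proj₁ ∘ point} λ {i} {j} eq →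
    decidable-stable (i Fin.≟ j) λ i≢j → disjoint i j i≢j
      (proj₁ (point i) ,
       x∈p∩q⁺ (proj₂ (point i) ,
               subst (_∈ lookup B j) (sym eq) (proj₂ (point j))))
  where
  point : (j : Fin r) → Nonempty (lookup B j)
  point j = sensitive⇒nonempty f x (lookup B j) (sens j)

bs-at-exists : ∀ {n} (f : BooleanFunction n) x →
               ∃ (IsMaximum (HasDisjointSensitiveBlocks f x))
bs-at-exists {n} f x =
  maximum (hasDisjointSensitiveBlocks? f x) ([] , (λ ()) , (λ ())) n (#blocks≤n f x)

bs-at : ∀ {n} → BooleanFunction n → Input n → ℕ
bs-at f x = proj₁ (bs-at-exists f x)

bs : ∀ {n} → BooleanFunction n → ℕ
bs f = max-over-inputs (bs-at f)

------------------------------------------------------------------------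
-- Certificate complexity

-- `nothing` plays the role of ∗.
PartialAssignment : ℕ → Set
PartialAssignment n = Vec (Maybe Bool) n

support : ∀ {n} → PartialAssignment n → Subset n
support p = map is-just p

codim : ∀ {n} → PartialAssignment n → ℕ
codim p = ∣ support p ∣

Consistent : ∀ {n} → Input n → PartialAssignment n → Set
Consistent x p = ∀ i → i ∈ support p → just (lookup x i) ≡ lookup p i

IsCertificate : ∀ {n} → BooleanFunction n → Bool → PartialAssignment n → Set
IsCertificate f b p = ∀ x → Consistent x p → f x ≡ b

HasCertificate : ∀ {n} → BooleanFunction n → Input n → ℕ → Set
HasCertificate {n} f x k = ∃ λ (p : PartialAssignment n) →
  IsCertificate f (f x) p × Consistent x p × codim p ≡ k

consistent? : ∀ {n} (x : Input n) p → Dec (Consistent x p)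
consistent? x p = Fin.all? λ i →
  (i ∈? support p) →-dec ≡-dec _≟_ (just (lookup x i)) (lookup p i)

hasCertificate? : ∀ {n} (f : BooleanFunction n) x → Decidable (HasCertificate f x)
hasCertificate? f x k = vec-search (maybe-search bool-search) λ p →
  searchable-all? (vec-search bool-search)
    (λ y → consistent? y p →-dec (f y ≟ f x))
  ×-dec consistent? x p
  ×-dec (codim p ℕ.≟ k)

total-consistent : ∀ {n} (x : Input n) → Consistent x (map just x)
total-consistent x i _ = sym (lookup-map i just x)

total-unique : ∀ {n} (x y : Input n) → Consistent y (map just x) → y ≡ x
total-unique []      []      _    = refl
total-unique (b ∷ x) (c ∷ y) cons =
  cong₂ _∷_ (just-injective (cons zero here))
            (total-unique x y λ i i∈ → cons (suc i) (there i∈))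

C-at-exists : ∀ {n} (f : BooleanFunction n) x → ∃ (IsMinimum (HasCertificate f x))
C-at-exists f x = minimum (hasCertificate? f x) (codim (map just x))
  (map just x , (λ y → cong f ∘ total-unique x y) , total-consistent x , refl)

C-at : ∀ {n} → BooleanFunction n → Input n → ℕ
C-at f x = proj₁ (C-at-exists f x)

C : ∀ {n} → BooleanFunction n → ℕ
C f = max-over-inputs (C-at f)

------------------------------------------------------------------------
-- Rational sequences

ℕ→ℚ : ℕ → ℚ
ℕ→ℚ k = + k / 1

-- 2 ^ (k - 1) without truncated subtraction: the value at 0 is 1/2.
pow2-pred : ℕ → ℚ
pow2-pred k = + (2 ℕ.^ k) / 2

-- Rational sequences suffice for an o(1) upper bound: every real null sequence
-- is dominated by a rational one (round ε k up to within 1 / (k + 1)).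
TendsToZero : (ℕ → ℚ) → Set
TendsToZero ε = ∀ δ → 0ℚ ℚ.< δ → ∃ λ N → ∀ k → N ≤ k → ℚ.∣ ε k ∣ ℚ.< δ

{-# OPTIONS --safe #-}
-- The block sensitivity is polynomial in s = s(f), so C(f) ≤ bs(f) s(f) is
-- o(2 ^ s) and the constant 8/9 is not needed; ε(s) is 4 (s + 1)⁶ / 2 ^ s.
-- By Huang's theorem the multilinear polynomial of f has degree below
-- D = (s + 1)²: a subcube of dimension D with nonzero alternating sum would
-- contain a point with s + 1 sensitive directions.  Given b disjoint sensitive
-- blocks at x, let P(t) be the expectation of ± f at x with each block flipped
-- independently with probability t.  Then P has degree below D, is bounded by 1
-- on [0, 1], and |P'(0)| = 2b.  For Q(t) = (P(t) - P(0)) / t, the vanishing of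
-- high central differences of x ↦ Q(x² / c), whose coefficients are largest in
-- the middle, bounds Q(0) = P'(0) by the values Q(x² / c), 1 ≤ x < D.

module Submission where

open import Defs
open import Data.Bool using (Bool; true; false; not; _xor_; _≟_; if_then_else_)
open import Data.Bool.Properties using (xor-comm; xor-assoc; xor-same; xor-identityʳ; not-involutive; ¬-not)
open import Data.Fin using (Fin; zero; suc; combine; remQuot; punchIn; punchOut)
import Data.Fin.Properties as Fin
open import Data.Fin.Subset using (Subset; ⊥; ⊤; ⁅_⁆; _∈_; _∉_; _⊆_; _∩_; _∪_; Nonempty; Empty)
  renaming (∣_∣ to size; _-_ to _∖_)
open import Data.Fin.Subset.Properties
  using (_∈?_; nonempty?; x∈p∩q⁺; x∈p∩q⁻; x∈p∧x≢y⇒x∈p-y; x∈p⇒∣p-x∣<∣p∣; x∈p∪q⁺; p─q⊆p; p─⊥≡p; ∣⊥∣≡0; ∣⊤∣≡n)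
open import Data.Integer using (+_; ℤ; 0ℤ; 1ℤ; _+_; _-_; _*_; -_; ∣_∣)
import Data.Integer as ℤ
import Data.Integer.Properties as ℤ
open import Data.Integer.Tactic.RingSolver using (solve-∀)
open import Data.List as List using (List; []; _∷_; _++_; length)
import Data.List.Properties as List
open import Data.List.Membership.Propositional using () renaming (_∈_ to _∈ˡ_)
import Data.List.Membership.Propositional.Properties as ∈ˡ
open import Data.List.Relation.Unary.Any as Any using (here; there)
import Data.List.Relation.Unary.Any.Properties as Any
open import Data.Maybe using (just; nothing)
open import Data.Maybe.Properties using (just-injective)
open import Data.Nat using (ℕ; zero; suc; _≤_; _<_; z≤n; s≤s)
import Data.Nat as ℕ
import Data.Nat.DivMod as ℕ
import Data.Nat.Properties as ℕ
import Data.Nat.Tactic.RingSolver as ℕRing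
open import Data.Product using (∃; _×_; _,_; proj₁; proj₂)
open import Data.Rational using (ℚ; _/_)
import Data.Rational as ℚ
import Data.Rational.Properties as ℚ
import Data.Rational.Unnormalised as ℚᵘ
import Data.Rational.Unnormalised.Properties as ℚᵘ
open import Data.Sum using (inj₁; inj₂)
open import Data.Unit using (tt) renaming (⊤ to Unit)
open import Data.Vec as Vec using (Vec; []; _∷_; lookup; tabulate; count; here; there)
open import Data.Vec.Properties using (lookup-zipWith; lookup-map; lookup∘tabulate; []=⇒lookup; lookup⇒[]=)
open import Function using (_∘_; id; _$_)
open import Relation.Binary.PropositionalEquality
  using (_≡_; _≢_; _≗_; refl; sym; trans; cong; cong₂; subst; subst₂; module ≡-Reasoning)
open import Relation.Nullary using (yes; no; contradiction)
open import Relation.Nullary.Decidable using (¬?; _×-dec_; decidable-stable)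
open import Relation.Binary.Definitions using (tri<; tri≈; tri>)
open import Relation.Unary using (Decidable)

-- Certificate complexity versus block sensitivity

-- A perfect square for `D` makes Huang's eigenvalue `s + 1` an integer, and eigenvectors come from
-- fraction-free elimination, so the spectral argument never leaves ℤ. Expectations are likewise
-- scaled by `c ^ b`, and degree is measured by vanishing differences instead of coefficients. The
-- analytic core is a Markov-type inequality for `P'(0)`. Substituting `t = x² / c` makes the
-- function even in `x`, so a symmetric stencil centred at 0 bounds the central value by the others
-- at a cost linear in the number of nodes; a one-sided difference would cost a factor exponential
-- in `D`. Division by `t` turns the central value into the derivative, and since `t ≥ 1 / c` at the
-- other nodes it costs at most `c`. The nodes have to be probabilities, so `c` has to be at least
-- `(D - 1)²`; the choice `c = D²` gives `b ≤ 2 D² (D - 1)`, of order `s⁶`.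

≤-max-over-inputs : ∀ {n} (g : Input n → ℕ) x → g x ≤ max-over-inputs g
≤-max-over-inputs g []          = ℕ.≤-refl
≤-max-over-inputs g (false ∷ x) = ℕ.≤-trans (≤-max-over-inputs (g ∘ (false ∷_)) x) (ℕ.m≤m⊔n _ _)
≤-max-over-inputs g (true ∷ x)  = ℕ.≤-trans (≤-max-over-inputs (g ∘ (true ∷_)) x) (ℕ.m≤n⊔m _ _)

max-over-inputs-≤ : ∀ {n m} (g : Input n → ℕ) → (∀ x → g x ≤ m) → max-over-inputs g ≤ m
max-over-inputs-≤ {zero}  g g≤m = g≤m []
max-over-inputs-≤ {suc n} g g≤m =
  ℕ.⊔-lub (max-over-inputs-≤ (g ∘ (false ∷_)) (g≤m ∘ (false ∷_)))
          (max-over-inputs-≤ (g ∘ (true ∷_)) (g≤m ∘ (true ∷_)))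

size≤count : ∀ {A : Set} {P : A → Set} (P? : Decidable P) {n} (B : Subset n) (g : Fin n → A) →
             (∀ {i} → i ∈ B → P (g i)) → size B ≤ count P? (tabulate g)
size≤count P? []       g Pg = z≤n
size≤count P? (b ∷ B)  g Pg with P? (g zero)
size≤count P? (true  ∷ B) g Pg | yes _ = s≤s (size≤count P? B (g ∘ suc) (Pg ∘ there))
size≤count P? (false ∷ B) g Pg | yes _ = ℕ.m≤n⇒m≤1+n (size≤count P? B (g ∘ suc) (Pg ∘ there))
size≤count P? (true  ∷ B) g Pg | no ¬p = contradiction (Pg here) ¬p
size≤count P? (false ∷ B) g Pg | no _  = size≤count P? B (g ∘ suc) (Pg ∘ there)

injection⇒size≤ : ∀ {m n} (J : Subset m) (S : Subset n) (g : Fin m → Fin n) →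
                  (∀ {i j} → g i ≡ g j → i ≡ j) → (∀ {j} → j ∈ J → g j ∈ S) → size J ≤ size S
injection⇒size≤ []          S g inj g∈ = z≤n
injection⇒size≤ (false ∷ J) S g inj g∈ =
  injection⇒size≤ J S (g ∘ suc) (Fin.suc-injective ∘ inj) (g∈ ∘ there)
injection⇒size≤ (true ∷ J)  S g inj g∈ = ℕ.≤-trans
  (s≤s (injection⇒size≤ J (S ∖ g zero) (g ∘ suc) (Fin.suc-injective ∘ inj)
    λ j∈ → x∈p∧x≢y⇒x∈p-y (g∈ (there j∈)) λ eq → Fin.0≢1+n (sym (inj eq))))
  (x∈p⇒∣p-x∣<∣p∣ (g∈ here))

size-∪ : ∀ {n} (p q : Subset n) → size (p ∪ q) ≤ size p ℕ.+ size q
size-∪ []          []          = z≤n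
size-∪ (false ∷ p) (false ∷ q) = size-∪ p q
size-∪ (true ∷ p)  (false ∷ q) = s≤s (size-∪ p q)
size-∪ (false ∷ p) (true ∷ q)  = ℕ.≤-trans (s≤s (size-∪ p q)) (ℕ.≤-reflexive (sym (ℕ.+-suc _ _)))
size-∪ (true ∷ p)  (true ∷ q)  =
  s≤s (ℕ.≤-trans (size-∪ p q) (ℕ.+-monoʳ-≤ (size p) (ℕ.n≤1+n _)))

⋃ : ∀ {n r} → (Fin r → Subset n) → Subset n
⋃ {r = zero}  B = ⊥
⋃ {r = suc r} B = B zero ∪ ⋃ (B ∘ suc)

⊆-⋃ : ∀ {n r} (B : Fin r → Subset n) j → B j ⊆ ⋃ B
⊆-⋃ B zero    i∈ = x∈p∪q⁺ (inj₁ i∈)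
⊆-⋃ B (suc j) i∈ = x∈p∪q⁺ (inj₂ (⊆-⋃ (B ∘ suc) j i∈))

size-⋃ : ∀ {n r k} (B : Fin r → Subset n) → (∀ j → size (B j) ≤ k) → size (⋃ B) ≤ r ℕ.* k
size-⋃ {n} {zero}  B B≤k = ℕ.≤-reflexive (∣⊥∣≡0 n)
size-⋃ {n} {suc r} B B≤k = ℕ.≤-trans (size-∪ (B zero) _)
  (ℕ.+-mono-≤ (B≤k zero) (size-⋃ (B ∘ suc) (B≤k ∘ suc)))

lookup-^-∉ : ∀ {n} (x : Input n) (B : Subset n) {i} → i ∉ B → lookup (x ^ B) i ≡ lookup x i
lookup-^-∉ (b ∷ x) (false ∷ B) {zero}  i∉ = xor-identityʳ b
lookup-^-∉ (b ∷ x) (true ∷ B)  {zero}  i∉ = contradiction here i∉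
lookup-^-∉ (b ∷ x) (c ∷ B)     {suc i} i∉ = lookup-^-∉ x B (i∉ ∘ there)

^-cancel : ∀ {n} (x y : Input n) → x ^ (x ^ y) ≡ y
^-cancel []      []      = refl
^-cancel (b ∷ x) (c ∷ y) = cong₂ _∷_
  (trans (sym (xor-assoc b b c)) (cong (_xor c) (xor-same b))) (^-cancel x y)

^-^-⁅⁆ : ∀ {n} (x : Input n) (B : Subset n) {i} → i ∈ B → x ^ B ^ ⁅ i ⁆ ≡ x ^ (B ∖ i)
^-^-⁅⁆ (b ∷ x) (true ∷ B) {zero}  here      = cong₂ _∷_
  (trans (xor-assoc b true true) refl) (trans (^-⊥ (x ^ B)) (cong (x ^_) (sym (p─⊥≡p B))))
^-^-⁅⁆ (b ∷ x) (c ∷ B)    {suc i} (there i∈) = cong₂ _∷_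
  (trans (xor-identityʳ (b xor c)) (cong (b xor_) (lem c))) (^-^-⁅⁆ x B i∈)
  where
  lem : ∀ c → c ≡ lookup ((c ∷ B) ∖ suc i) zero
  lem true  = refl
  lem false = refl

-- A sensitive block missing the support of a certificate could be flipped without leaving the
-- certificate. So each block meets the support, and by disjointness the meeting points are
-- distinct.
bs-at≤C-at : ∀ {n} (f : BooleanFunction n) x → bs-at f x ≤ C-at f x
bs-at≤C-at f x with bs-at-exists f x | C-at-exists f x
... | r , isMax | _ , isMin with IsMaximum.attained isMax | IsMinimum.attained isMin
... | B , disjoint , sens | p , cert , cons , refl =
  subst (_≤ codim p) (∣⊤∣≡n r) $
    injection⇒size≤ ⊤ (support p) (proj₁ ∘ meet) injective (λ {j} _ → proj₁ (meet∈ j))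
  where
  meet : ∀ j → Nonempty (support p ∩ lookup B j)
  meet j = decidable-stable (nonempty? _) λ disj → sens j $ sym $ cert (x ^ lookup B j) λ i i∈ →
    trans (cong just (lookup-^-∉ x (lookup B j) λ i∈B → disj (i , x∈p∩q⁺ (i∈ , i∈B)))) (cons i i∈)
  meet∈ : ∀ j → proj₁ (meet j) ∈ support p × proj₁ (meet j) ∈ lookup B j
  meet∈ j = x∈p∩q⁻ _ _ (proj₂ (meet j))
  injective : ∀ {i j} → proj₁ (meet i) ≡ proj₁ (meet j) → i ≡ j
  injective {i} {j} eq = decidable-stable (i Fin.≟ j) λ i≢j → disjoint i j i≢j
    (_ , x∈p∩q⁺ (proj₂ (meet∈ i) , subst (_∈ lookup B j) (sym eq) (proj₂ (meet∈ j))))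

bs≤C : ∀ {n} (f : BooleanFunction n) → bs f ≤ C f
bs≤C f = max-over-inputs-≤ (bs-at f) λ x → ℕ.≤-trans (bs-at≤C-at f x) (≤-max-over-inputs (C-at f) x)

-- Only removals of single elements are tested; this already makes every element of `B` a sensitive
-- coordinate at `x ^ B`.
MinimalSensitive : ∀ {n} → BooleanFunction n → Input n → Subset n → Set
MinimalSensitive f x B = f x ≢ f (x ^ B) × (∀ {i} → i ∈ B → f x ≡ f (x ^ (B ∖ i)))

-- `k` is fuel: every removal of an element lowers the size of the block.
shrink : ∀ {n} (f : BooleanFunction n) x k B → size B ≤ k → f x ≢ f (x ^ B) →
         ∃ λ B′ → B′ ⊆ B × MinimalSensitive f x B′
shrink f x k B B≤k sens with Fin.any? (λ i → (i ∈? B) ×-dec ¬? (f x ≟ f (x ^ (B ∖ i))))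
... | no none = B , id , sens , λ {i} i∈ →
  decidable-stable (f x ≟ f (x ^ (B ∖ i))) λ neq → none (i , i∈ , neq)
shrink f x zero    B B≤k sens | yes (i , i∈ , sens′) =
  contradiction (ℕ.<-≤-trans (x∈p⇒∣p-x∣<∣p∣ i∈) B≤k) λ ()
shrink f x (suc k) B B≤k sens | yes (i , i∈ , sens′)
  with shrink f x k (B ∖ i) (ℕ.≤-pred (ℕ.<-≤-trans (x∈p⇒∣p-x∣<∣p∣ i∈) B≤k)) sens′
... | B′ , B′⊆ , minimal = B′ , p─q⊆p B ⁅ i ⁆ ∘ B′⊆ , minimal

-- Seen from `x ^ B`, flipping any `i ∈ B` back leads to `x ^ (B ∖ i)`, where `f` has returned to
-- the value `f x`.
size-minimal≤s : ∀ {n} (f : BooleanFunction n) x B → MinimalSensitive f x B → size B ≤ s f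
size-minimal≤s f x B (sens , minimal) = ℕ.≤-trans
  (size≤count _ B id λ i∈ eq →
    sens (trans (minimal i∈) (sym (trans eq (cong f (^-^-⁅⁆ x B i∈))))))
  (≤-max-over-inputs (s-at f) (x ^ B))

restrict : ∀ {n} → Subset n → Input n → PartialAssignment n
restrict = Vec.zipWith λ c b → if c then just b else nothing

support-restrict : ∀ {n} (U : Subset n) x → support (restrict U x) ≡ U
support-restrict []          []      = refl
support-restrict (false ∷ U) (b ∷ x) = cong (false ∷_) (support-restrict U x)
support-restrict (true ∷ U)  (b ∷ x) = cong (true ∷_) (support-restrict U x)

lookup-restrict : ∀ {n} (U : Subset n) x {i} → i ∈ U → lookup (restrict U x) i ≡ just (lookup x i)
lookup-restrict (_ ∷ U) (b ∷ x) here       = refl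
lookup-restrict (_ ∷ U) (b ∷ x) (there i∈) = lookup-restrict U x i∈

∷-disjoint : ∀ {n r} (B : Subset n) (Bs : Vec (Subset n) r) →
             (∀ j → Empty (B ∩ lookup Bs j)) → PairwiseDisjoint Bs → PairwiseDisjoint (B ∷ Bs)
∷-disjoint B Bs new old zero    zero    i≢j = contradiction refl i≢j
∷-disjoint B Bs new old zero    (suc j) i≢j = new j
∷-disjoint B Bs new old (suc i) zero    i≢j (k , k∈) with x∈p∩q⁻ (lookup Bs i) B k∈
... | k∈Bs , k∈B = new i (k , x∈p∩q⁺ (k∈B , k∈Bs))
∷-disjoint B Bs new old (suc i) (suc j) i≢j = old i j (i≢j ∘ cong suc)

∷-sensitive : ∀ {n r} (f : BooleanFunction n) x B (Bs : Vec (Subset n) r) →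
              f x ≢ f (x ^ B) → AllSensitive f x Bs → AllSensitive f x (B ∷ Bs)
∷-sensitive f x B Bs sens senss zero    = sens
∷-sensitive f x B Bs sens senss (suc j) = senss j

-- The blocks of a maximum family can be taken minimal, hence of size at most
-- s f, and fixing x on their union certifies f x.
C-at≤bs*s : ∀ {n} (f : BooleanFunction n) x → C-at f x ≤ bs-at f x ℕ.* s f
C-at≤bs*s {n} f x with bs-at-exists f x | C-at-exists f x
... | r , isMax | c , isMin with IsMaximum.attained isMax
... | B , disjoint , sens = ℕ.≤-trans
  (IsMinimum.bound isMin
    (restrict U x , cert ,
     (λ i i∈ → sym (lookup-restrict U x (subst (i ∈_) (support-restrict U x) i∈))) ,
     cong size (support-restrict U x)))
  (size-⋃ block λ j → size-minimal≤s f x (block j) (proj₂ (proj₂ (shrunk j))))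
  where
  shrunk : ∀ j → ∃ λ B′ → B′ ⊆ lookup B j × MinimalSensitive f x B′
  shrunk j = shrink f x _ (lookup B j) ℕ.≤-refl (sens j)
  block : Fin r → Subset n
  block j = proj₁ (shrunk j)
  U = ⋃ block
  cert : IsCertificate f (f x) (restrict U x)
  -- Read as a subset, `x ^ y` is the set where `x` and `y` differ. It avoids `U`, and if `f y`
  -- differed from `f x` it would extend the maximum family by one sensitive block.
  cert y cons = decidable-stable (f y ≟ f x) λ neq → ℕ.1+n≰n $ IsMaximum.bound isMax
    ( (x ^ y) ∷ Vec.tabulate block
    , ∷-disjoint (x ^ y) (tabulate block)
        (λ j → λ (i , i∈) → let i∈new , i∈old = x∈p∩q⁻ (x ^ y) _ i∈ in
          outside-U i i∈new (⊆-⋃ block j (subst (i ∈_) (lookup∘tabulate block j) i∈old)))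
        (λ i j i≢j → λ (k , k∈) → let k∈i , k∈j = x∈p∩q⁻ _ _ k∈ in
          disjoint i j i≢j (k , x∈p∩q⁺
            ( proj₁ (proj₂ (shrunk i)) (subst (k ∈_) (lookup∘tabulate block i) k∈i)
            , proj₁ (proj₂ (shrunk j)) (subst (k ∈_) (lookup∘tabulate block j) k∈j))))
    , ∷-sensitive f x (x ^ y) (tabulate block)
        (λ eq → neq (sym (trans eq (cong f (^-cancel x y)))))
        (λ j eq → proj₁ (proj₂ (proj₂ (shrunk j)))
          (trans eq (cong (λ B → f (x ^ B)) (lookup∘tabulate block j)))))
    where
    outside-U : ∀ i → i ∈ x ^ y → i ∉ U
    outside-U i i∈ i∈U = contradiction
      (trans (sym ([]=⇒lookup i∈)) (trans (lookup-zipWith _xor_ i x y)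
        (trans (cong (lookup x i xor_) yᵢ≡xᵢ) (xor-same (lookup x i))))) λ ()
      where
      yᵢ≡xᵢ : lookup y i ≡ lookup x i
      yᵢ≡xᵢ = just-injective (trans
        (cons i (subst (i ∈_) (sym (support-restrict U x)) i∈U)) (lookup-restrict U x i∈U))

-- Homogeneous linear systems over ℤ

linComb : ∀ {N} → ℤ → Vec ℤ N → ℤ → Vec ℤ N → Vec ℤ N
linComb a u b v = Vec.zipWith (λ p q → a * p + b * q) u v

Linear : ∀ {N} → (Vec ℤ N → ℤ) → Set
Linear L = ∀ a u b v → L (linComb a u b v) ≡ a * L u + b * L v

e₀ : ∀ {N} → Vec ℤ (suc N)
e₀ = 1ℤ ∷ Vec.replicate _ 0ℤ

-- Substitutes x₀ = - L (0 ∷ t), after scaling the other unknowns by a = L e₀.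
eliminate : ∀ {N} → (Vec ℤ (suc N) → ℤ) → Vec ℤ N → Vec ℤ (suc N)
eliminate L t = - L (0ℤ ∷ t) ∷ Vec.map (L e₀ *_) t

eliminate-root : ∀ {N} (L : Vec ℤ (suc N) → ℤ) → Linear L → ∀ t → L (eliminate L t) ≡ 0ℤ
eliminate-root L lin t = begin
  L (eliminate L t)                             ≡⟨ cong L (cong₂ _∷_ head≡ (tail≡ t)) ⟨
  L (linComb (- L (0ℤ ∷ t)) e₀ (L e₀) (0ℤ ∷ t)) ≡⟨ lin (- L (0ℤ ∷ t)) e₀ (L e₀) (0ℤ ∷ t) ⟩
  - L (0ℤ ∷ t) * L e₀ + L e₀ * L (0ℤ ∷ t)       ≡⟨ cancels (L (0ℤ ∷ t)) (L e₀) ⟩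
  0ℤ                                            ∎
  where
  open ≡-Reasoning
  cancels : ∀ x a → - x * a + a * x ≡ 0ℤ
  cancels = solve-∀
  head : ∀ x a → - x * 1ℤ + a * 0ℤ ≡ - x
  head = solve-∀
  head≡ = head (L (0ℤ ∷ t)) (L e₀)
  entry : ∀ x a b → - x * 0ℤ + a * b ≡ a * b
  entry = solve-∀
  tail≡ : ∀ {N} (t′ : Vec ℤ N) →
          linComb (- L (0ℤ ∷ t)) (Vec.replicate N 0ℤ) (L e₀) t′ ≡ Vec.map (L e₀ *_) t′
  tail≡ []       = refl
  tail≡ (b ∷ t′) = cong₂ _∷_ (entry (L (0ℤ ∷ t)) (L e₀) b) (tail≡ t′)

eliminate-linComb : ∀ {N} (L : Vec ℤ (suc N) → ℤ) → Linear L → ∀ a u b v →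
  eliminate L (linComb a u b v) ≡ linComb a (eliminate L u) b (eliminate L v)
eliminate-linComb L lin a u b v = cong₂ _∷_
  (trans (cong (λ z → - L (z ∷ linComb a u b v)) (zeros a b))
    (trans (cong -_ (lin a (0ℤ ∷ u) b (0ℤ ∷ v))) (negate a (L (0ℤ ∷ u)) b (L (0ℤ ∷ v)))))
  (tail≡ u v)
  where
  zeros : ∀ a b → 0ℤ ≡ a * 0ℤ + b * 0ℤ
  zeros = solve-∀
  negate : ∀ a x b y → - (a * x + b * y) ≡ a * - x + b * - y
  negate = solve-∀
  entry : ∀ c a p b q → c * (a * p + b * q) ≡ a * (c * p) + b * (c * q)
  entry = solve-∀
  tail≡ : ∀ {N} (u v : Vec ℤ N) →
          Vec.map (L e₀ *_) (linComb a u b v) ≡ linComb a (Vec.map (L e₀ *_) u) b (Vec.map (L e₀ *_) v)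
  tail≡ []      []      = refl
  tail≡ (p ∷ u) (q ∷ v) = cong₂ _∷_ (entry (L e₀) a p b q) (tail≡ u v)

-- If no equation involves the first unknown, `e₀` is a solution. Otherwise an equation with a
-- nonzero pivot is used up to eliminate that unknown. Scaling by the pivot replaces division and
-- preserves nonzero entries, as ℤ has no zero divisors.
nontrivial-solution : ∀ {m N} → m < N → (L : Fin m → Vec ℤ N → ℤ) → (∀ r → Linear (L r)) →
                      ∃ λ u → (∃ λ c → lookup u c ≢ 0ℤ) × (∀ r → L r u ≡ 0ℤ)
nontrivial-solution {m} {suc N} m<N L lin with Fin.any? (λ r → ¬? (L r e₀ ℤ.≟ 0ℤ))
... | no allZero =
  e₀ , (zero , λ ()) , λ r → decidable-stable (L r e₀ ℤ.≟ 0ℤ) λ ≢0 → allZero (r , ≢0)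
nontrivial-solution {suc m} {suc N} (s≤s m<N) L lin | yes (r , pivot≢0)
  with nontrivial-solution m<N (λ i t → L (punchIn r i) (eliminate (L r) t))
         (λ i a u b v → trans (cong (L (punchIn r i)) (eliminate-linComb (L r) (lin r) a u b v))
                              (lin (punchIn r i) a _ b _))
... | t , (c , tc≢0) , roots =
  eliminate (L r) t , (suc c , scaled≢0) , all-roots
  where
  scaled≢0 : lookup (Vec.map (L r e₀ *_) t) c ≢ 0ℤ
  scaled≢0 eq with ℤ.i*j≡0⇒i≡0∨j≡0 (L r e₀) (trans (sym (lookup-map c (L r e₀ *_) t)) eq)
  ... | inj₁ z = pivot≢0 z
  ... | inj₂ z = tc≢0 z
  all-roots : ∀ r′ → L r′ (eliminate (L r) t) ≡ 0ℤ
  all-roots r′ with r Fin.≟ r′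
  ... | yes refl = eliminate-root (L r) (lin r) t
  ... | no r≢r′  = subst (λ i → L i (eliminate (L r) t) ≡ 0ℤ) (Fin.punchIn-punchOut r≢r′)
                         (roots (punchOut r≢r′))

-- Huang's signed adjacency matrix of the cube

-- In blocks over the first bit, the matrix is [[A, I], [I, -A]].
A : ∀ {n} → (Input n → ℤ) → Input n → ℤ
A v []          = 0ℤ
A v (false ∷ x) = A (v ∘ (false ∷_)) x + v (true ∷ x)
A v (true ∷ x)  = v (false ∷ x) - A (v ∘ (true ∷_)) x

A-cong : ∀ {n} {v w : Input n → ℤ} → v ≗ w → A v ≗ A w
A-cong v≗w []          = refl
A-cong v≗w (false ∷ x) = cong₂ _+_ (A-cong (v≗w ∘ (false ∷_)) x) (v≗w (true ∷ x))
A-cong v≗w (true ∷ x)  = cong₂ _-_ (v≗w (false ∷ x)) (A-cong (v≗w ∘ (true ∷_)) x)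

A-linear : ∀ {n} a (v : Input n → ℤ) b w x → A (λ y → a * v y + b * w y) x ≡ a * A v x + b * A w x
A-linear a v b w [] = zeros a b
  where
  zeros : ∀ a b → 0ℤ ≡ a * 0ℤ + b * 0ℤ
  zeros = solve-∀
A-linear a v b w (false ∷ x) =
  trans (cong (λ z → z + (a * v (true ∷ x) + b * w (true ∷ x)))
              (A-linear a (v ∘ (false ∷_)) b (w ∘ (false ∷_)) x))
        (rearrange a (A (v ∘ (false ∷_)) x) (v (true ∷ x)) b (A (w ∘ (false ∷_)) x) (w (true ∷ x)))
  where
  rearrange : ∀ a p p′ b q q′ → a * p + b * q + (a * p′ + b * q′) ≡ a * (p + p′) + b * (q + q′)
  rearrange = solve-∀
A-linear a v b w (true ∷ x) =
  trans (cong (λ z → a * v (false ∷ x) + b * w (false ∷ x) - z)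
              (A-linear a (v ∘ (true ∷_)) b (w ∘ (true ∷_)) x))
        (rearrange a (v (false ∷ x)) (A (v ∘ (true ∷_)) x) b (w (false ∷ x)) (A (w ∘ (true ∷_)) x))
  where
  rearrange : ∀ a p p′ b q q′ → a * p + b * q - (a * p′ + b * q′) ≡ a * (p - p′) + b * (q - q′)
  rearrange = solve-∀

-- Squaring the block form, the off-diagonal terms `A - A` cancel and the diagonal ones are A² + I,
-- so each dimension adds 1.
A-square : ∀ {n} (v : Input n → ℤ) x → A (A v) x ≡ + n * v x
A-square v [] = sym (ℤ.*-zeroˡ (v []))
A-square {suc n} v (false ∷ x) = begin
  A (λ y → A v₀ y + v₁ y) x + (v₀ x - A v₁ x)
    ≡⟨ cong (_+ (v₀ x - A v₁ x)) (trans (A-cong ones x) (A-linear 1ℤ (A v₀) 1ℤ v₁ x)) ⟩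
  1ℤ * A (A v₀) x + 1ℤ * A v₁ x + (v₀ x - A v₁ x)
    ≡⟨ cong (λ z → 1ℤ * z + 1ℤ * A v₁ x + (v₀ x - A v₁ x)) (A-square v₀ x) ⟩
  1ℤ * (+ n * v₀ x) + 1ℤ * A v₁ x + (v₀ x - A v₁ x)
    ≡⟨ collect (+ n) (v₀ x) (A v₁ x) ⟩
  (1ℤ + + n) * v₀ x ∎
  where
  open ≡-Reasoning
  v₀ = v ∘ (false ∷_)
  v₁ = v ∘ (true ∷_)
  one : ∀ p q → p + q ≡ 1ℤ * p + 1ℤ * q
  one = solve-∀
  ones : ∀ y → A v₀ y + v₁ y ≡ 1ℤ * A v₀ y + 1ℤ * v₁ y
  ones y = one (A v₀ y) (v₁ y)
  collect : ∀ m p q → 1ℤ * (m * p) + 1ℤ * q + (p - q) ≡ (1ℤ + m) * p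
  collect = solve-∀
A-square {suc n} v (true ∷ x) = begin
  A v₀ x + v₁ x - A (λ y → v₀ y - A v₁ y) x
    ≡⟨ cong (λ z → A v₀ x + v₁ x - z) (trans (A-cong ones x) (A-linear 1ℤ v₀ (- 1ℤ) (A v₁) x)) ⟩
  A v₀ x + v₁ x - (1ℤ * A v₀ x + - 1ℤ * A (A v₁) x)
    ≡⟨ cong (λ z → A v₀ x + v₁ x - (1ℤ * A v₀ x + - 1ℤ * z)) (A-square v₁ x) ⟩
  A v₀ x + v₁ x - (1ℤ * A v₀ x + - 1ℤ * (+ n * v₁ x))
    ≡⟨ collect (+ n) (v₁ x) (A v₀ x) ⟩
  (1ℤ + + n) * v₁ x ∎
  where
  open ≡-Reasoning
  v₀ = v ∘ (false ∷_)
  v₁ = v ∘ (true ∷_)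
  one : ∀ p q → p - q ≡ 1ℤ * p + - 1ℤ * q
  one = solve-∀
  ones : ∀ y → v₀ y - A v₁ y ≡ 1ℤ * v₀ y + - 1ℤ * A v₁ y
  ones y = one (v₀ y) (A v₁ y)
  collect : ∀ m p q → q + p - (1ℤ * q + - 1ℤ * (m * p)) ≡ (1ℤ + m) * p
  collect = solve-∀

-- An eigenvector of A for an eigenvalue k with k² = n + 1 is determined by its
-- restriction u to a facet, and u is arbitrary.
eigenvector : ∀ {n} → ℤ → (Input n → ℤ) → Input (suc n) → ℤ
eigenvector k u (false ∷ x) = u x
eigenvector k u (true ∷ x)  = k * u x - A u x

-- On the false facet the definition of the other half solves the equation for any `k`. On the true
-- facet, A² = n reduces it to `(n + 1) u = k² u`.
A-eigenvector : ∀ {n} k → k * k ≡ + suc n → (u : Input n → ℤ) →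
                ∀ x → A (eigenvector k u) x ≡ k * eigenvector k u x
A-eigenvector k k²≡n u (false ∷ x) = cancels (A u x) (k * u x)
  where
  cancels : ∀ p q → p + (q - p) ≡ q
  cancels = solve-∀
A-eigenvector {n} k k²≡n u (true ∷ x) = begin
  u x - A (λ y → k * u y - A u y) x
    ≡⟨ cong (λ z → u x - z) (trans (A-cong ones x) (A-linear k u (- 1ℤ) (A u) x)) ⟩
  u x - (k * A u x + - 1ℤ * A (A u) x)
    ≡⟨ cong (λ z → u x - (k * A u x + - 1ℤ * z)) (A-square u x) ⟩
  u x - (k * A u x + - 1ℤ * (+ n * u x))
    ≡⟨ collect (+ n) k (u x) (A u x) ⟩
  (1ℤ + + n) * u x - k * A u x
    ≡⟨ cong (λ z → z * u x - k * A u x) k²≡n ⟨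
  k * k * u x - k * A u x
    ≡⟨ factor k (u x) (A u x) ⟩
  k * (k * u x - A u x) ∎
  where
  open ≡-Reasoning
  one : ∀ p q → p - q ≡ p + - 1ℤ * q
  one = solve-∀
  ones : ∀ y → k * u y - A u y ≡ k * u y + - 1ℤ * A u y
  ones y = one (k * u y) (A u y)
  collect : ∀ m k p q → p - (k * q + - 1ℤ * (m * p)) ≡ (1ℤ + m) * p - k * q
  collect = solve-∀
  factor : ∀ k p q → k * k * p - k * q ≡ k * (k * p - q)
  factor = solve-∀

eigenvector-cong : ∀ {n} k {u w : Input n → ℤ} → u ≗ w → eigenvector k u ≗ eigenvector k w
eigenvector-cong k u≗w (false ∷ x) = u≗w x
eigenvector-cong k u≗w (true ∷ x)  = cong₂ (λ p q → k * p - q) (u≗w x) (A-cong u≗w x)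

eigenvector-linear : ∀ {n} k a (u : Input n → ℤ) b w x →
  eigenvector k (λ y → a * u y + b * w y) x ≡ a * eigenvector k u x + b * eigenvector k w x
eigenvector-linear k a u b w (false ∷ x) = refl
eigenvector-linear k a u b w (true ∷ x)  =
  trans (cong (λ z → k * (a * u x + b * w x) - z) (A-linear a u b w x))
        (rearrange k a (u x) (A u x) b (w x) (A w x))
  where
  rearrange : ∀ k a p p′ b q q′ →
              k * (a * p + b * q) - (a * p′ + b * q′) ≡ a * (k * p - p′) + b * (k * q - q′)
  rearrange = solve-∀

-- Eigenvectors with prescribed zeros

bit : Bool → Fin 2
bit false = zero
bit true  = suc zero

fromBit : Fin 2 → Bool
fromBit zero       = false
fromBit (suc zero) = true

bit-fromBit : ∀ i → bit (fromBit i) ≡ i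
bit-fromBit zero       = refl
bit-fromBit (suc zero) = refl

index : ∀ {n} → Input n → Fin (2 ℕ.^ n)
index []      = zero
index (b ∷ x) = combine (bit b) (index x)

fromIndex : ∀ n → Fin (2 ℕ.^ n) → Input n
fromIndex zero    _ = []
fromIndex (suc n) i = fromBit (proj₁ (remQuot {2} (2 ℕ.^ n) i)) ∷ fromIndex n (proj₂ (remQuot {2} (2 ℕ.^ n) i))

index-fromIndex : ∀ n i → index (fromIndex n i) ≡ i
index-fromIndex zero    zero = refl
index-fromIndex (suc n) i    = trans
  (cong₂ combine (bit-fromBit (proj₁ (remQuot {2} (2 ℕ.^ n) i)))
                 (index-fromIndex n (proj₂ (remQuot {2} (2 ℕ.^ n) i))))
  (Fin.combine-remQuot {2} (2 ℕ.^ n) i)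

-- The eigenspace has 2ⁿ free parameters, the values of `u`, and vanishing on `K` imposes fewer
-- linear conditions. This dimension count takes the place of eigenvalue interlacing.
eigenvector-vanishing-on : ∀ {n} k (K : List (Input (suc n))) → length K < 2 ℕ.^ n →
  ∃ λ (u : Input n → ℤ) → (∃ λ x → u x ≢ 0ℤ) × (∀ {x} → x ∈ˡ K → eigenvector k u x ≡ 0ℤ)
eigenvector-vanishing-on {n} k K K<2ⁿ =
  let t , (c , tc≢0) , roots = nontrivial-solution K<2ⁿ L L-linear in
  decode t ,
  (fromIndex n c , λ eq → tc≢0 (trans (cong (lookup t) (sym (index-fromIndex n c))) eq)) ,
  λ x∈ → trans (cong (eigenvector k (decode t)) (Any.lookup-index x∈)) (roots (Any.index x∈))
  where
  decode : Vec ℤ (2 ℕ.^ n) → Input n → ℤ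
  decode t x = lookup t (index x)
  L : Fin (length K) → Vec ℤ (2 ℕ.^ n) → ℤ
  L r t = eigenvector k (decode t) (List.lookup K r)
  L-linear : ∀ r → Linear (L r)
  L-linear r a u b v = trans
    (eigenvector-cong k (λ x → lookup-zipWith _ (index x) u v) (List.lookup K r))
    (eigenvector-linear k a (decode u) b (decode v) (List.lookup K r))

argmax : ∀ {n} (g : Input n → ℕ) → ∃ λ x → ∀ y → g y ≤ g x
argmax {zero}  g = [] , λ { [] → ℕ.≤-refl }
argmax {suc n} g with argmax (g ∘ (false ∷_)) | argmax (g ∘ (true ∷_))
... | x₀ , max₀ | x₁ , max₁ with ℕ.≤-total (g (false ∷ x₀)) (g (true ∷ x₁))
... | inj₁ le = true ∷ x₁ ,
  λ { (false ∷ y) → ℕ.≤-trans (max₀ y) le ; (true ∷ y) → max₁ y }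
... | inj₂ ge = false ∷ x₀ ,
  λ { (false ∷ y) → max₀ y ; (true ∷ y) → ℕ.≤-trans (max₁ y) ge }

-- Row `x` of the matrix has one entry ±1 for each neighbour of `x`, and only the neighbours in
-- directions from `J` can contribute.
∣A∣≤ : ∀ {n} (v : Input n → ℤ) (J : Subset n) x {M} → (∀ y → ∣ v y ∣ ≤ M) →
       (∀ j → j ∉ J → v (x ^ ⁅ j ⁆) ≡ 0ℤ) → ∣ A v x ∣ ≤ size J ℕ.* M
∣A∣≤ v []      []      v≤M v≡0 = z≤n
∣A∣≤ v (c ∷ J) (b ∷ x) {M} v≤M v≡0 = bound b c v≡0
  where
  v₀ = v ∘ (false ∷_)
  v₁ = v ∘ (true ∷_)
  tail : ∀ b {c} → (∀ j → j ∉ c ∷ J → v ((b ∷ x) ^ ⁅ j ⁆) ≡ 0ℤ) →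
         ∀ j → j ∉ J → v (b ∷ (x ^ ⁅ j ⁆)) ≡ 0ℤ
  tail b v≡0 j j∉ = trans (cong (λ c → v (c ∷ (x ^ ⁅ j ⁆))) (sym (xor-identityʳ b)))
                          (v≡0 (suc j) λ { (there j∈) → j∉ j∈ })
  bound : ∀ b c → (∀ j → j ∉ c ∷ J → v ((b ∷ x) ^ ⁅ j ⁆) ≡ 0ℤ) → ∣ A v (b ∷ x) ∣ ≤ size (c ∷ J) ℕ.* M
  bound false true v≡0 = begin
    ∣ A v₀ x + v₁ x ∣         ≤⟨ ℤ.∣i+j∣≤∣i∣+∣j∣ (A v₀ x) (v₁ x) ⟩
    ∣ A v₀ x ∣ ℕ.+ ∣ v₁ x ∣   ≤⟨ ℕ.+-mono-≤ (∣A∣≤ v₀ J x (v≤M ∘ (false ∷_)) (tail false v≡0)) (v≤M (true ∷ x)) ⟩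
    size J ℕ.* M ℕ.+ M        ≡⟨ ℕ.+-comm _ M ⟩
    M ℕ.+ size J ℕ.* M        ∎
    where open ℕ.≤-Reasoning
  bound true true v≡0 = ℕ.≤-trans (ℤ.∣i-j∣≤∣i∣+∣j∣ (v₀ x) (A v₁ x))
    (ℕ.+-mono-≤ (v≤M (false ∷ x)) (∣A∣≤ v₁ J x (v≤M ∘ (true ∷_)) (tail true v≡0)))
  bound false false v≡0 = begin
    ∣ A v₀ x + v₁ x ∣ ≡⟨ cong (λ z → ∣ A v₀ x + z ∣) (trans (cong v₁ (sym (^-⊥ x))) (v≡0 zero λ ())) ⟩
    ∣ A v₀ x + 0ℤ ∣   ≡⟨ cong ∣_∣ (ℤ.+-identityʳ (A v₀ x)) ⟩
    ∣ A v₀ x ∣        ≤⟨ ∣A∣≤ v₀ J x (v≤M ∘ (false ∷_)) (tail false v≡0) ⟩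
    size J ℕ.* M      ∎
    where open ℕ.≤-Reasoning
  bound true false v≡0 = begin
    ∣ v₀ x - A v₁ x ∣ ≡⟨ cong (λ z → ∣ z - A v₁ x ∣) (trans (cong v₀ (sym (^-⊥ x))) (v≡0 zero λ ())) ⟩
    ∣ 0ℤ - A v₁ x ∣   ≡⟨ cong ∣_∣ (ℤ.+-identityˡ (- A v₁ x)) ⟩
    ∣ - A v₁ x ∣      ≡⟨ ℤ.∣-i∣≡∣i∣ (A v₁ x) ⟩
    ∣ A v₁ x ∣        ≤⟨ ∣A∣≤ v₁ J x (v≤M ∘ (true ∷_)) (tail true v≡0) ⟩
    size J ℕ.* M      ∎
    where open ℕ.≤-Reasoning

-- Huang's theorem for unbalanced functions

points : ∀ {n} → (Input n → Bool) → List (Input n)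
points {zero}  P = if P [] then [] ∷ [] else []
points {suc n} P = List.map (false ∷_) (points (P ∘ (false ∷_))) ++ List.map (true ∷_) (points (P ∘ (true ∷_)))

∈-points : ∀ {n} (P : Input n → Bool) x → P x ≡ true → x ∈ˡ points P
∈-points P []          eq rewrite eq = here refl
∈-points P (false ∷ x) eq = ∈ˡ.∈-++⁺ˡ (∈ˡ.∈-map⁺ (false ∷_) (∈-points (P ∘ (false ∷_)) x eq))
∈-points P (true ∷ x)  eq =
  ∈ˡ.∈-++⁺ʳ (List.map (false ∷_) (points (P ∘ (false ∷_))))
            (∈ˡ.∈-map⁺ (true ∷_) (∈-points (P ∘ (true ∷_)) x eq))

#points : ∀ {n} → (Input n → Bool) → ℕ
#points P = length (points P)

#points-∷ : ∀ {n} (P : Input (suc n) → Bool) →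
            #points P ≡ #points (P ∘ (false ∷_)) ℕ.+ #points (P ∘ (true ∷_))
#points-∷ P = trans (List.length-++ (List.map (false ∷_) (points (P ∘ (false ∷_)))))
  (cong₂ ℕ._+_ (List.length-map (false ∷_) (points (P ∘ (false ∷_))))
               (List.length-map (true ∷_) (points (P ∘ (true ∷_)))))

#points-cong : ∀ {n} {P Q : Input n → Bool} → P ≗ Q → #points P ≡ #points Q
#points-cong {zero}          P≗Q = cong (λ b → length (if b then [] ∷ [] else [])) (P≗Q [])
#points-cong {suc n} {P} {Q} P≗Q = begin
  #points P
    ≡⟨ #points-∷ P ⟩
  #points (P ∘ (false ∷_)) ℕ.+ #points (P ∘ (true ∷_))
    ≡⟨ cong₂ ℕ._+_ (#points-cong (P≗Q ∘ (false ∷_))) (#points-cong (P≗Q ∘ (true ∷_))) ⟩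
  #points (Q ∘ (false ∷_)) ℕ.+ #points (Q ∘ (true ∷_))
    ≡⟨ #points-∷ Q ⟨
  #points Q ∎
  where open ≡-Reasoning

#points-complement : ∀ {n} (P : Input n → Bool) → #points P ℕ.+ #points (not ∘ P) ≡ 2 ℕ.^ n
#points-complement {zero} P with P []
... | true  = refl
... | false = refl
#points-complement {suc n} P = begin
  #points P ℕ.+ #points (not ∘ P)
    ≡⟨ cong₂ ℕ._+_ (#points-∷ P) (#points-∷ (not ∘ P)) ⟩
  (p₀ ℕ.+ p₁) ℕ.+ (q₀ ℕ.+ q₁)
    ≡⟨ interchange p₀ p₁ q₀ q₁ ⟩
  (p₀ ℕ.+ q₀) ℕ.+ ((p₁ ℕ.+ q₁) ℕ.+ 0)
    ≡⟨ cong₂ (λ a b → a ℕ.+ (b ℕ.+ 0)) (#points-complement (P ∘ (false ∷_)))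
                                       (#points-complement (P ∘ (true ∷_))) ⟩
  2 ℕ.^ suc n ∎
  where
  open ≡-Reasoning
  p₀ = #points (P ∘ (false ∷_))
  p₁ = #points (P ∘ (true ∷_))
  q₀ = #points (not ∘ P ∘ (false ∷_))
  q₁ = #points (not ∘ P ∘ (true ∷_))
  interchange : ∀ a b c d → (a ℕ.+ b) ℕ.+ (c ℕ.+ d) ≡ (a ℕ.+ c) ℕ.+ ((b ℕ.+ d) ℕ.+ 0)
  interchange = ℕRing.solve-∀

-- Up to sign, the coefficient of the full monomial in the multilinear polynomial of `F`.
alternatingSum : ∀ {n} → (Input n → ℤ) → ℤ
alternatingSum {zero}  F = F []
alternatingSum {suc n} F = alternatingSum (F ∘ (false ∷_)) - alternatingSum (F ∘ (true ∷_))

sgn : Bool → ℤ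
sgn true  = 1ℤ
sgn false = - 1ℤ

parity : ∀ {n} → Input n → Bool
parity []      = false
parity (b ∷ x) = b xor parity x

parity-flip : ∀ {n} (x : Input n) j → parity (x ^ ⁅ j ⁆) ≡ not (parity x)
parity-flip (true ∷ x)  zero    rewrite ^-⊥ x = sym (not-involutive (parity x))
parity-flip (false ∷ x) zero    rewrite ^-⊥ x = refl
parity-flip (true ∷ x)  (suc j) = cong not (parity-flip x j)
parity-flip (false ∷ x) (suc j) = parity-flip x j

_⊕parity : ∀ {n} → BooleanFunction n → BooleanFunction n
(h ⊕parity) x = h x xor parity x

xor-not : ∀ a b → a xor not b ≡ not (a xor b)
xor-not true  b = refl
xor-not false b = refl

-- The sign of a point in the alternating sum is its parity, so it can be absorbed into the
-- function; what remains is the imbalance between the two classes of `h ⊕parity`.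
alternatingSum-sgn : ∀ {n} (h : BooleanFunction n) →
  alternatingSum (sgn ∘ h) ≡ + #points (h ⊕parity) - + #points (not ∘ (h ⊕parity))
alternatingSum-sgn {zero} h rewrite xor-identityʳ (h []) with h []
... | true  = refl
... | false = refl
alternatingSum-sgn {suc n} h = begin
  alternatingSum (sgn ∘ h₀) - alternatingSum (sgn ∘ h₁)
    ≡⟨ cong₂ _-_ (alternatingSum-sgn h₀) (alternatingSum-sgn h₁) ⟩
  + p₀ - + q₀ - (+ p₁ - + q₁)
    ≡⟨ regroup (+ p₀) (+ q₀) (+ p₁) (+ q₁) ⟩
  + (p₀ ℕ.+ q₁) - + (q₀ ℕ.+ p₁)
    ≡⟨ cong₂ (λ a b → + a - + b) p≡ q≡ ⟨
  + #points (h ⊕parity) - + #points (not ∘ (h ⊕parity)) ∎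
  where
  open ≡-Reasoning
  h₀ = h ∘ (false ∷_)
  h₁ = h ∘ (true ∷_)
  p₀ = #points (h₀ ⊕parity)
  q₀ = #points (not ∘ (h₀ ⊕parity))
  p₁ = #points (h₁ ⊕parity)
  q₁ = #points (not ∘ (h₁ ⊕parity))
  p≡ : #points (h ⊕parity) ≡ p₀ ℕ.+ q₁
  p≡ = trans (#points-∷ (h ⊕parity)) (cong (p₀ ℕ.+_) (#points-cong λ x → xor-not (h₁ x) (parity x)))
  q≡ : #points (not ∘ (h ⊕parity)) ≡ q₀ ℕ.+ p₁
  q≡ = trans (#points-∷ (not ∘ (h ⊕parity))) (cong (q₀ ℕ.+_) (#points-cong λ x →
    trans (cong not (xor-not (h₁ x) (parity x))) (not-involutive ((h₁ ⊕parity) x))))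
  regroup : ∀ a b c d → a - b - (c - d) ≡ (a + d) - (b + c)
  regroup = solve-∀

sensitiveSet : ∀ {n} → BooleanFunction n → Input n → Subset n
sensitiveSet h x = tabulate λ j → h x xor h (x ^ ⁅ j ⁆)

xor≡true⇒≢ : ∀ {a b} → a xor b ≡ true → a ≢ b
xor≡true⇒≢ {a} eq refl = contradiction (trans (sym eq) (xor-same a)) λ ()

xor≢true⇒≡ : ∀ {a b} → a xor b ≢ true → a ≡ b
xor≢true⇒≡ {true}  {true}  _  = refl
xor≢true⇒≡ {true}  {false} ¬t = contradiction refl ¬t
xor≢true⇒≡ {false} {true}  ¬t = contradiction refl ¬t
xor≢true⇒≡ {false} {false} _  = refl

∈-sensitiveSet : ∀ {n} (h : BooleanFunction n) x {j} → j ∈ sensitiveSet h x → h x ≢ h (x ^ ⁅ j ⁆)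
∈-sensitiveSet h x {j} j∈ = xor≡true⇒≢ (trans (sym (lookup∘tabulate _ j)) ([]=⇒lookup j∈))

∉-sensitiveSet : ∀ {n} (h : BooleanFunction n) x {j} → j ∉ sensitiveSet h x → h x ≡ h (x ^ ⁅ j ⁆)
∉-sensitiveSet h x {j} j∉ = xor≢true⇒≡ λ eq →
  j∉ (lookup⇒[]= j (sensitiveSet h x) (trans (lookup∘tabulate _ j) eq))

-- The eigenvector vanishing off the majority class of G forces a large degree
-- at its largest entry; within a class of G, cube edges are sensitive for h.
large-class⇒sensitive : ∀ {n k} (h G : BooleanFunction (suc n)) → k ℕ.* k ≡ suc n →
  (∀ x j → h x ≡ h (x ^ ⁅ j ⁆) → G (x ^ ⁅ j ⁆) ≡ not (G x)) →
  #points (not ∘ G) < 2 ℕ.^ n → ∃ λ x → k ≤ size (sensitiveSet h x)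
large-class⇒sensitive {n} {k} h G k²≡n flips few
  with eigenvector-vanishing-on (+ k) (points (not ∘ G)) few
... | u , (x₀ , ux₀≢0) , vanishes with argmax (λ x → ∣ eigenvector (+ k) u x ∣)
... | x , v≤vx = x , ℕ.*-cancelʳ-≤ k (size J) ∣ v x ∣ {{ℕ.>-nonZero ∣vx∣>0}} (begin
  k ℕ.* ∣ v x ∣        ≡⟨ ℤ.∣i*j∣≡∣i∣*∣j∣ (+ k) (v x) ⟨
  ∣ + k * v x ∣        ≡⟨ cong ∣_∣ (A-eigenvector (+ k) (trans (sym (ℤ.pos-* k k)) (cong +_ k²≡n)) u x) ⟨
  ∣ A v x ∣            ≤⟨ ∣A∣≤ v J x v≤vx neighbour≡0 ⟩
  size J ℕ.* ∣ v x ∣   ∎)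
  where
  open ℕ.≤-Reasoning
  v = eigenvector (+ k) u
  J = sensitiveSet h x
  v≡0 : ∀ y → G y ≡ false → v y ≡ 0ℤ
  v≡0 y eq = vanishes (∈-points (not ∘ G) y (cong not eq))
  ∣vx∣>0 : 0 < ∣ v x ∣
  ∣vx∣>0 = ℕ.<-≤-trans (ℕ.n≢0⇒n>0 (ux₀≢0 ∘ ℤ.∣i∣≡0⇒i≡0)) (v≤vx (false ∷ x₀))
  Gx : G x ≡ true
  Gx with G x in eq
  ... | true  = refl
  ... | false = contradiction (cong ∣_∣ (v≡0 x eq)) (ℕ.>⇒≢ ∣vx∣>0)
  neighbour≡0 : ∀ j → j ∉ J → v (x ^ ⁅ j ⁆) ≡ 0ℤ
  neighbour≡0 j j∉ = v≡0 _ (trans (flips x j (∉-sensitiveSet h x j∉)) (cong not Gx))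

<⇒<half : ∀ {a b} n → a ℕ.+ b ≡ 2 ℕ.^ suc n → a < b → a < 2 ℕ.^ n
<⇒<half {a} {b} n a+b≡ a<b = ℕ.*-cancelˡ-< 2 a (2 ℕ.^ n) (begin-strict
  2 ℕ.* a           ≡⟨ cong (a ℕ.+_) (ℕ.+-identityʳ a) ⟩
  a ℕ.+ a           <⟨ ℕ.+-monoʳ-< a a<b ⟩
  a ℕ.+ b           ≡⟨ a+b≡ ⟩
  2 ℕ.^ suc n       ∎)
  where open ℕ.≤-Reasoning

-- Crossing an edge changes the parity, so a cube edge along which `h` is constant joins the two
-- classes of `h ⊕parity`. Whichever class holds more than half of the cube serves as `G`; the
-- minority then has fewer points than the eigenspace has dimensions.
unbalanced⇒sensitive : ∀ {n k} (h : BooleanFunction (suc n)) → k ℕ.* k ≡ suc n →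
  alternatingSum (sgn ∘ h) ≢ 0ℤ → ∃ λ x → k ≤ size (sensitiveSet h x)
unbalanced⇒sensitive {n} h k²≡n unbalanced
  with ℕ.<-cmp (#points (h ⊕parity)) (#points (not ∘ (h ⊕parity)))
... | tri≈ _ eq _ = contradiction
  (trans (alternatingSum-sgn h) (trans (cong (λ a → + a - + #points (not ∘ (h ⊕parity))) eq)
         (ℤ.+-inverseʳ (+ #points (not ∘ (h ⊕parity))))))
  unbalanced
... | tri> _ _ gt = large-class⇒sensitive h (h ⊕parity) k²≡n
  (λ x j eq → trans (cong₂ _xor_ (sym eq) (parity-flip x j)) (xor-not (h x) (parity x)))
  (<⇒<half n (trans (ℕ.+-comm _ (#points (h ⊕parity))) (#points-complement (h ⊕parity))) gt)
... | tri< lt _ _ = large-class⇒sensitive h (not ∘ (h ⊕parity)) k²≡n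
  (λ x j eq → cong not (trans (cong₂ _xor_ (sym eq) (parity-flip x j)) (xor-not (h x) (parity x))))
  (subst (_< 2 ℕ.^ n) (#points-cong λ x → sym (not-involutive ((h ⊕parity) x)))
    (<⇒<half n (#points-complement (h ⊕parity)) lt))

-- Iterated differences of a Boolean function

^-comm : ∀ {n} (x : Input n) B B′ → x ^ B ^ B′ ≡ x ^ B′ ^ B
^-comm []      []      []        = refl
^-comm (b ∷ x) (c ∷ B) (c′ ∷ B′) = cong₂ _∷_
  (trans (xor-assoc b c c′) (trans (cong (b xor_) (xor-comm c c′)) (sym (xor-assoc b c′ c))))
  (^-comm x B B′)

^-involutive : ∀ {n} (x : Input n) B → x ^ B ^ B ≡ x
^-involutive []      []      = refl
^-involutive (b ∷ x) (c ∷ B) = cong₂ _∷_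
  (trans (xor-assoc b c c) (trans (cong (b xor_) (xor-same c)) (xor-identityʳ b)))
  (^-involutive x B)

flipBlocks : ∀ {n b} → Vec (Subset n) b → Input b → Input n → Input n
flipBlocks []       []          x = x
flipBlocks (B ∷ Bs) (false ∷ y) x = flipBlocks Bs y x
flipBlocks (B ∷ Bs) (true ∷ y)  x = flipBlocks Bs y (x ^ B)

flipBlocks-^ : ∀ {n b} (Bs : Vec (Subset n) b) y x B → flipBlocks Bs y (x ^ B) ≡ flipBlocks Bs y x ^ B
flipBlocks-^ []        []          x B = refl
flipBlocks-^ (B′ ∷ Bs) (false ∷ y) x B = flipBlocks-^ Bs y x B
flipBlocks-^ (B′ ∷ Bs) (true ∷ y)  x B =
  trans (cong (flipBlocks Bs y) (^-comm x B B′)) (flipBlocks-^ Bs y (x ^ B′) B)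

flipBlocks-⊥ : ∀ {n b} (Bs : Vec (Subset n) b) x → flipBlocks Bs ⊥ x ≡ x
flipBlocks-⊥ []       x = refl
flipBlocks-⊥ (B ∷ Bs) x = flipBlocks-⊥ Bs x

flipBlocks-flip : ∀ {n b} (Bs : Vec (Subset n) b) y j x →
                  flipBlocks Bs (y ^ ⁅ j ⁆) x ≡ flipBlocks Bs y x ^ lookup Bs j
flipBlocks-flip (B ∷ Bs) (false ∷ y) zero    x =
  trans (cong (λ y → flipBlocks Bs y (x ^ B)) (^-⊥ y)) (flipBlocks-^ Bs y x B)
flipBlocks-flip (B ∷ Bs) (true ∷ y)  zero    x = trans (cong (λ y → flipBlocks Bs y x) (^-⊥ y))
  (trans (cong (flipBlocks Bs y) (sym (^-involutive x B))) (flipBlocks-^ Bs y (x ^ B) B))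
flipBlocks-flip (B ∷ Bs) (false ∷ y) (suc j) x = flipBlocks-flip Bs y j x
flipBlocks-flip (B ∷ Bs) (true ∷ y)  (suc j) x = flipBlocks-flip Bs y j (x ^ B)

Δ : ∀ {n} → Subset n → (Input n → ℤ) → Input n → ℤ
Δ B F x = F (x ^ B) - F x

Except : ∀ {n} → (Fin n → Set) → Fin n → Fin n → Set
Except U i j = U j × j ≢ i

-- All D-fold differences of F along distinct coordinates in U vanish; for
-- U = [n] this says that the multilinear polynomial of F has degree below D.
Vanishes : ∀ {n} → ℕ → (Fin n → Set) → (Input n → ℤ) → Set
Vanishes zero    U F = ∀ x → F x ≡ 0ℤ
Vanishes (suc D) U F = ∀ i → U i → Vanishes D (Except U i) (Δ ⁅ i ⁆ F)

Vanishes-resp : ∀ {n} D {U : Fin n → Set} {F G : Input n → ℤ} → F ≗ G → Vanishes D U F → Vanishes D U G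
Vanishes-resp zero    F≗G van x    = trans (sym (F≗G x)) (van x)
Vanishes-resp (suc D) F≗G van i Ui =
  Vanishes-resp D (λ x → cong₂ _-_ (F≗G (x ^ ⁅ i ⁆)) (F≗G x)) (van i Ui)

Vanishes-⊆ : ∀ {n} D {U V : Fin n → Set} {F : Input n → ℤ} → (∀ {i} → V i → U i) →
             Vanishes D U F → Vanishes D V F
Vanishes-⊆ zero    V⊆U van      = van
Vanishes-⊆ (suc D) V⊆U van i Vi = Vanishes-⊆ D (λ (Vj , j≢i) → V⊆U Vj , j≢i) (van i (V⊆U Vi))

Vanishes-0 : ∀ {n} D {U : Fin n → Set} → Vanishes D U (λ _ → 0ℤ)
Vanishes-0 zero    x    = refl
Vanishes-0 (suc D) i Ui = Vanishes-0 D

Vanishes-+ : ∀ {n} D {U : Fin n → Set} {F G : Input n → ℤ} → Vanishes D U F → Vanishes D U G →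
             Vanishes D U (λ x → F x + G x)
Vanishes-+ zero    vanF vanG x    = cong₂ _+_ (vanF x) (vanG x)
Vanishes-+ (suc D) {F = F} {G} vanF vanG i Ui =
  Vanishes-resp D (λ x → regroup (F (x ^ ⁅ i ⁆)) (F x) (G (x ^ ⁅ i ⁆)) (G x))
    (Vanishes-+ D (vanF i Ui) (vanG i Ui))
  where
  regroup : ∀ a b c d → (a - b) + (c - d) ≡ (a + c) - (b + d)
  regroup = solve-∀

Vanishes-shift : ∀ {n} D {U : Fin n → Set} {F : Input n → ℤ} B → Vanishes D U F →
                 Vanishes D U (λ x → F (x ^ B))
Vanishes-shift zero    B van x    = van (x ^ B)
Vanishes-shift (suc D) {F = F} B van i Ui =
  Vanishes-resp D (λ x → cong (λ z → F z - F (x ^ B)) (^-comm x B ⁅ i ⁆))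
    (Vanishes-shift D B (van i Ui))

elements : ∀ {n} → Subset n → List (Fin n)
elements []          = []
elements (true ∷ B)  = zero ∷ List.map suc (elements B)
elements (false ∷ B) = List.map suc (elements B)

∈-elements : ∀ {n} (B : Subset n) {i} → i ∈ˡ elements B → i ∈ B
∈-elements (true ∷ B)  (here refl) = here
∈-elements (true ∷ B)  (there i∈) with ∈ˡ.∈-map⁻ suc i∈
... | _ , j∈ , refl = there (∈-elements B j∈)
∈-elements (false ∷ B) i∈ with ∈ˡ.∈-map⁻ suc i∈
... | _ , j∈ , refl = there (∈-elements B j∈)

flips : ∀ {n} → List (Fin n) → Input n → Input n
flips []      x = x
flips (i ∷ l) x = flips l x ^ ⁅ i ⁆

flips-suc : ∀ {n} (l : List (Fin n)) b x → flips (List.map suc l) (b ∷ x) ≡ b ∷ flips l x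
flips-suc []      b x = refl
flips-suc (i ∷ l) b x rewrite flips-suc l b x = cong (_∷ (flips l x ^ ⁅ i ⁆)) (xor-identityʳ b)

flips-elements : ∀ {n} (B : Subset n) x → flips (elements B) x ≡ x ^ B
flips-elements []          []      = refl
flips-elements (false ∷ B) (b ∷ x) =
  trans (flips-suc (elements B) b x) (cong₂ _∷_ (sym (xor-identityʳ b)) (flips-elements B x))
flips-elements (true ∷ B)  (b ∷ x) rewrite flips-suc (elements B) b x =
  cong₂ _∷_ refl (trans (^-⊥ (flips (elements B) x)) (flips-elements B x))

Vanishes-flips : ∀ {n} D {U : Fin n → Set} {F : Input n → ℤ} l → Vanishes D U F →
                 Vanishes D U (F ∘ flips l)
Vanishes-flips D []      van = van
Vanishes-flips D (i ∷ l) van = Vanishes-flips D l (Vanishes-shift D ⁅ i ⁆ van)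

-- A block difference telescopes into differences along its elements.
Vanishes-Δ-block : ∀ {n} D {U : Fin n → Set} {F : Input n → ℤ} (B : Subset n) →
  (∀ {i} → i ∈ B → U i) → Vanishes (suc D) U F → Vanishes D (λ i → U i × i ∉ B) (Δ B F)
Vanishes-Δ-block D {U} {F} B B⊆U van =
  Vanishes-resp D (λ x → cong (λ z → F z - F x) (flips-elements B x))
    (telescope (elements B) (∈-elements B))
  where
  telescope : ∀ l → (∀ {i} → i ∈ˡ l → i ∈ B) → Vanishes D (λ i → U i × i ∉ B) (λ x → F (flips l x) - F x)
  telescope []      l⊆B = Vanishes-resp D (λ x → sym (ℤ.+-inverseʳ (F x))) (Vanishes-0 D)
  telescope (i ∷ l) l⊆B =
    Vanishes-resp D (λ x → chain (F (flips l x ^ ⁅ i ⁆)) (F (flips l x)) (F x))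
      (Vanishes-+ D
        -- Each summand of the telescope excludes only its own direction `i`; restricting all of
        -- them to directions off `B` makes them addable.
        (Vanishes-⊆ D (λ (Uj , j∉B) → Uj , λ { refl → j∉B i∈B })
          (Vanishes-flips D l (van i (B⊆U i∈B))))
        (telescope l (l⊆B ∘ there)))
    where
    i∈B = l⊆B (here refl)
    chain : ∀ a b c → (a - b) + (b - c) ≡ a - c
    chain = solve-∀

-- Degree of the multilinear polynomial, read off from its expansion in the first variable,
-- `g₀ + y₁ (g₁ - g₀)`: the second coefficient must have degree one lower.
Degree< : ∀ {b} → ℕ → (Input b → ℤ) → Set
Degree< zero g                = ∀ y → g y ≡ 0ℤ
Degree< {zero}  (suc D) g     = Unit
Degree< {suc b} (suc D) g     = Degree< (suc D) (g ∘ (false ∷_)) ×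
                                Degree< D (λ y → g (true ∷ y) - g (false ∷ y))

Degree<-resp : ∀ {b} D {g h : Input b → ℤ} → g ≗ h → Degree< D g → Degree< D h
Degree<-resp zero    g≗h deg y = trans (sym (g≗h y)) (deg y)
Degree<-resp {zero}  (suc D) g≗h deg = tt
Degree<-resp {suc b} (suc D) g≗h (deg₀ , degΔ) =
  Degree<-resp (suc D) (g≗h ∘ (false ∷_)) deg₀ ,
  Degree<-resp D (λ y → cong₂ _-_ (g≗h (true ∷ y)) (g≗h (false ∷ y))) degΔ

-- The difference in one block bit is `Δ B F`, which spends one order of vanishing and all
-- directions in `B`. Disjointness keeps the remaining blocks inside the directions still allowed.
degree-on-blocks : ∀ {n b} D {U : Fin n → Set} {F : Input n → ℤ} (Bs : Vec (Subset n) b) →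
  PairwiseDisjoint Bs → (∀ j {i} → i ∈ lookup Bs j → U i) → Vanishes D U F →
  ∀ x → Degree< D (λ y → F (flipBlocks Bs y x))
degree-on-blocks zero    Bs disj Bs⊆U van x y = van (flipBlocks Bs y x)
degree-on-blocks (suc D) [] disj Bs⊆U van x   = tt
degree-on-blocks (suc D) {U} {F} (B ∷ Bs) disj Bs⊆U van x =
  degree-on-blocks (suc D) {F = F} Bs disj′ (Bs⊆U ∘ suc) van x ,
  Degree<-resp D (λ y → cong (λ z → F z - F (flipBlocks Bs y x)) (sym (flipBlocks-^ Bs y x B)))
    (degree-on-blocks D {F = Δ B F} Bs disj′
      (λ j i∈ → Bs⊆U (suc j) i∈ , λ i∈B → disj zero (suc j) (λ ()) (_ , x∈p∩q⁺ (i∈B , i∈)))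
      (Vanishes-Δ-block D {F = F} B (Bs⊆U zero) van) x)
  where
  disj′ : PairwiseDisjoint Bs
  disj′ i j i≢j = disj (suc i) (suc j) (i≢j ∘ Fin.suc-injective)

-- Degree from balanced subcubes

Distinct : ∀ {n D} → (Fin n → Set) → Vec (Fin n) D → Set
Distinct U []       = Unit
Distinct U (i ∷ is) = U i × Distinct (Except U i) is

Distinct-lookup : ∀ {n D} {U : Fin n → Set} (is : Vec (Fin n) D) → Distinct U is → ∀ j → U (lookup is j)
Distinct-lookup (i ∷ is) (Ui , dist) zero    = Ui
Distinct-lookup (i ∷ is) (Ui , dist) (suc j) = proj₁ (Distinct-lookup is dist j)

Distinct⇒injective : ∀ {n D} {U : Fin n → Set} (is : Vec (Fin n) D) → Distinct U is →
                     ∀ {j k} → lookup is j ≡ lookup is k → j ≡ k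
Distinct⇒injective (i ∷ is) (Ui , dist) {zero}  {zero}  eq = refl
Distinct⇒injective (i ∷ is) (Ui , dist) {zero}  {suc k} eq =
  contradiction (sym eq) (proj₂ (Distinct-lookup is dist k))
Distinct⇒injective (i ∷ is) (Ui , dist) {suc j} {zero}  eq =
  contradiction eq (proj₂ (Distinct-lookup is dist j))
Distinct⇒injective (i ∷ is) (Ui , dist) {suc j} {suc k} eq = cong suc (Distinct⇒injective is dist eq)

alternatingSum-- : ∀ {n} (F G : Input n → ℤ) →
                   alternatingSum (λ y → F y - G y) ≡ alternatingSum F - alternatingSum G
alternatingSum-- {zero}  F G = refl
alternatingSum-- {suc n} F G = trans
  (cong₂ _-_ (alternatingSum-- (F ∘ (false ∷_)) (G ∘ (false ∷_)))
             (alternatingSum-- (F ∘ (true ∷_)) (G ∘ (true ∷_))))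
  (regroup (alternatingSum (F ∘ (false ∷_))) (alternatingSum (G ∘ (false ∷_)))
           (alternatingSum (F ∘ (true ∷_))) (alternatingSum (G ∘ (true ∷_))))
  where
  regroup : ∀ a b c d → (a - b) - (c - d) ≡ (a - c) - (b - d)
  regroup = solve-∀

alternatingSum-cong : ∀ {n} {F G : Input n → ℤ} → F ≗ G → alternatingSum F ≡ alternatingSum G
alternatingSum-cong {zero}  F≗G = F≗G []
alternatingSum-cong {suc n} F≗G =
  cong₂ _-_ (alternatingSum-cong (F≗G ∘ (false ∷_))) (alternatingSum-cong (F≗G ∘ (true ∷_)))

-- A `D`-fold difference at `x` along distinct coordinates is, up to sign, the alternating sum over
-- the subcube they span at `x`.
balanced⇒Vanishes : ∀ {n} D {U : Fin n → Set} (F : Input n → ℤ) →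
  (∀ (is : Vec (Fin n) D) → Distinct U is → ∀ x →
     alternatingSum (λ y → F (flipBlocks (Vec.map ⁅_⁆ is) y x)) ≡ 0ℤ) →
  Vanishes D U F
balanced⇒Vanishes zero    F balanced x    = balanced [] tt x
balanced⇒Vanishes (suc D) F balanced i Ui = balanced⇒Vanishes D (Δ ⁅ i ⁆ F) λ is dist x →
  let Bs = Vec.map ⁅_⁆ is
      F₀ = λ y → F (flipBlocks Bs y x)
      F₁ = λ y → F (flipBlocks Bs y (x ^ ⁅ i ⁆))
  in begin
    alternatingSum (λ y → Δ ⁅ i ⁆ F (flipBlocks Bs y x))
      ≡⟨ alternatingSum-cong (λ y → cong (λ z → F z - F₀ y) (sym (flipBlocks-^ Bs y x ⁅ i ⁆))) ⟩
    alternatingSum (λ y → F₁ y - F₀ y)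
      ≡⟨ alternatingSum-- F₁ F₀ ⟩
    alternatingSum F₁ - alternatingSum F₀
      ≡⟨ swap (alternatingSum F₁) (alternatingSum F₀) ⟩
    - (alternatingSum F₀ - alternatingSum F₁)
      ≡⟨ cong -_ (balanced (i ∷ is) (Ui , dist) x) ⟩
    0ℤ ∎
  where
  open ≡-Reasoning
  swap : ∀ a b → a - b ≡ - (b - a)
  swap = solve-∀

sensitiveSet⁺ : ∀ {n} (f : BooleanFunction n) x {j} → f x ≢ f (x ^ ⁅ j ⁆) → j ∈ sensitiveSet f x
sensitiveSet⁺ f x {j} sens = decidable-stable (j ∈? sensitiveSet f x) λ j∉ → sens (∉-sensitiveSet f x j∉)

-- Flipping bit `j` in the subcube flips coordinate `lookup is j` in the large cube, so injectivity
-- carries distinct sensitive directions to distinct ones.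
subcube-sensitivity : ∀ {n D} (f : BooleanFunction n) (is : Vec (Fin n) D) →
  (∀ {j k} → lookup is j ≡ lookup is k → j ≡ k) → ∀ x y →
  size (sensitiveSet (λ y → f (flipBlocks (Vec.map ⁅_⁆ is) y x)) y) ≤ s f
subcube-sensitivity f is injective x y = begin
  size (sensitiveSet h y)
    ≤⟨ injection⇒size≤ (sensitiveSet h y) (sensitiveSet f z) (lookup is) injective (λ {j} j∈ →
         sensitiveSet⁺ f z (subst (λ w → f z ≢ f w) (flip≡ j) (∈-sensitiveSet h y j∈))) ⟩
  size (sensitiveSet f z)
    ≤⟨ size≤count _ (sensitiveSet f z) id (∈-sensitiveSet f z) ⟩
  s-at f z
    ≤⟨ ≤-max-over-inputs (s-at f) z ⟩
  s f ∎
  where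
  open ℕ.≤-Reasoning
  Bs = Vec.map ⁅_⁆ is
  h : BooleanFunction _
  h y = f (flipBlocks Bs y x)
  z = flipBlocks Bs y x
  flip≡ : ∀ j → flipBlocks Bs (y ^ ⁅ j ⁆) x ≡ z ^ ⁅ lookup is j ⁆
  flip≡ j = trans (flipBlocks-flip Bs y j x) (cong (z ^_) (lookup-map j ⁅_⁆ is))

-- Huang's theorem in the form deg f < k² whenever s(f) < k.
s<k⇒Vanishes : ∀ {n k} (f : BooleanFunction n) → s f < k → Vanishes (k ℕ.* k) (λ _ → Unit) (sgn ∘ f)
s<k⇒Vanishes {k = suc k} f s<k = balanced⇒Vanishes (suc k ℕ.* suc k) (sgn ∘ f) λ is dist x →
  decidable-stable (_ ℤ.≟ 0ℤ) λ unbalanced →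
    let y , k≤ = unbalanced⇒sensitive {k = suc k} (λ y → f (flipBlocks (Vec.map ⁅_⁆ is) y x)) refl unbalanced
    in ℕ.<⇒≱ s<k (ℕ.≤-trans k≤ (subcube-sensitivity f is (Distinct⇒injective is dist) x y))

-- Integer functions annihilated by iterated differences

forwardDifference : (ℤ → ℤ) → ℤ → ℤ
forwardDifference r x = r (1ℤ + x) - r x

PolyDegree< : ℕ → (ℤ → ℤ) → Set
PolyDegree< zero    r = ∀ x → r x ≡ 0ℤ
PolyDegree< (suc n) r = PolyDegree< n (forwardDifference r)

poly-resp : ∀ n {r t : ℤ → ℤ} → r ≗ t → PolyDegree< n r → PolyDegree< n t
poly-resp zero    r≗t p x = trans (sym (r≗t x)) (p x)
poly-resp (suc n) r≗t p   = poly-resp n (λ x → cong₂ _-_ (r≗t (1ℤ + x)) (r≗t x)) p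

poly-0 : ∀ n → PolyDegree< n (λ _ → 0ℤ)
poly-0 zero    x = refl
poly-0 (suc n)   = poly-0 n

poly-const : ∀ n a → PolyDegree< (suc n) (λ _ → a)
poly-const n a = poly-resp n (λ _ → sym (ℤ.+-inverseʳ a)) (poly-0 n)

poly-+ : ∀ n {r t : ℤ → ℤ} → PolyDegree< n r → PolyDegree< n t → PolyDegree< n (λ x → r x + t x)
poly-+ zero            p q x = cong₂ _+_ (p x) (q x)
poly-+ (suc n) {r} {t} p q   =
  poly-resp n (λ x → regroup (r (1ℤ + x)) (r x) (t (1ℤ + x)) (t x)) (poly-+ n p q)
  where
  regroup : ∀ a b c d → (a - b) + (c - d) ≡ (a + c) - (b + d)
  regroup = solve-∀

poly-scale : ∀ n {r : ℤ → ℤ} a → PolyDegree< n r → PolyDegree< n (λ x → a * r x)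
poly-scale zero        a p x = trans (cong (a *_) (p x)) (ℤ.*-zeroʳ a)
poly-scale (suc n) {r} a p   =
  poly-resp n (λ x → distrib a (r (1ℤ + x)) (r x)) (poly-scale n a p)
  where
  distrib : ∀ a p q → a * (p - q) ≡ a * p - a * q
  distrib = solve-∀

poly-shift : ∀ n {r : ℤ → ℤ} a → PolyDegree< n r → PolyDegree< n (λ x → r (a + x))
poly-shift zero        a p x = p (a + x)
poly-shift (suc n) {r} a p   =
  poly-resp n (λ x → cong (λ z → r z - r (a + x)) (swap a x)) (poly-shift n a p)
  where
  swap : ∀ a x → 1ℤ + (a + x) ≡ a + (1ℤ + x)
  swap = solve-∀

-- Discrete Leibniz rule: the difference of `x * r x` is `x` times the difference of `r`, plus a
-- shift of `r`.
poly-x* : ∀ n {r : ℤ → ℤ} → PolyDegree< n r → PolyDegree< (suc n) (λ x → x * r x)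
poly-x* n {r} p = poly-resp n (λ x → leibniz x (r (1ℤ + x)) (r x)) (difference n p)
  where
  leibniz : ∀ x p q → x * (p - q) + p ≡ (1ℤ + x) * p - x * q
  leibniz = solve-∀
  difference : ∀ n → PolyDegree< n r →
               PolyDegree< n (λ x → x * forwardDifference r x + r (1ℤ + x))
  difference zero    p x = trans
    (cong₂ (λ a b → x * (a - b) + a) (p (1ℤ + x)) (p x)) (cong (_+ 0ℤ) (ℤ.*-zeroʳ x))
  difference (suc n) p   = poly-+ (suc n) {λ x → x * forwardDifference r x} {λ x → r (1ℤ + x)}
                           (poly-x* n p) (poly-shift (suc n) {r} 1ℤ p)

centralDifference : (ℤ → ℤ) → ℤ → ℤ
centralDifference r x = (r x + r x) - r (1ℤ + x) - r (- 1ℤ + x)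

-- Up to sign, this is the second forward difference based at `x - 1`.
poly-centralDifference : ∀ n {r : ℤ → ℤ} → PolyDegree< (suc (suc n)) r → PolyDegree< n (centralDifference r)
poly-centralDifference n {r} p = poly-resp n shifted (poly-scale n (- 1ℤ) (poly-shift n (- 1ℤ) p))
  where
  one : ∀ x → 1ℤ + (- 1ℤ + x) ≡ x
  one = solve-∀
  two : ∀ x → 1ℤ + (1ℤ + (- 1ℤ + x)) ≡ 1ℤ + x
  two = solve-∀
  regroup : ∀ a b c → - 1ℤ * ((a - b) - (b - c)) ≡ (b + b) - a - c
  regroup = solve-∀
  shifted : ∀ x → - 1ℤ * forwardDifference (forwardDifference r) (- 1ℤ + x) ≡ centralDifference r x
  shifted x = trans
    (cong₂ (λ a b → - 1ℤ * ((r a - r b) - (r b - r (- 1ℤ + x)))) (two x) (one x))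
    (regroup (r (1ℤ + x)) (r x) (r (- 1ℤ + x)))

Even : (ℤ → ℤ) → Set
Even r = ∀ x → r (- x) ≡ r x

even-centralDifference : ∀ {r} → Even r → Even (centralDifference r)
even-centralDifference {r} even x = trans
  (cong₂ (λ a b → (r (- x) + r (- x)) - r a - r b) (right x) (left x))
  (trans (cong₂ (λ a b → (a + a) - b - r (- (1ℤ + x))) (even x) (even (- 1ℤ + x)))
    (trans (cong (λ a → (r x + r x) - r (- 1ℤ + x) - a) (even (1ℤ + x)))
      (swap (r x + r x) (r (- 1ℤ + x)) (r (1ℤ + x)))))
  where
  right : ∀ x → 1ℤ + - x ≡ - (- 1ℤ + x)
  right = solve-∀
  left : ∀ x → - 1ℤ + - x ≡ - (1ℤ + x)
  left = solve-∀
  swap : ∀ a b c → a - b - c ≡ a - c - b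
  swap = solve-∀

-- σ is minus the second central difference of an even function on ℤ, folded
-- to ℕ and twisted by the alternating sign.
σ : (ℕ → ℤ) → ℕ → ℤ
σ e zero    = (e 0 + e 0) + (e 1 + e 1)
σ e (suc k) = e k + (e (suc k) + e (suc k)) + e (suc (suc k))

iterate-σ : ℕ → (ℕ → ℤ) → ℕ → ℤ
iterate-σ zero    e = e
iterate-σ (suc n) e = iterate-σ n (σ e)

altSign : ℕ → ℤ
altSign zero    = 1ℤ
altSign (suc k) = - altSign k

-- Each round replaces `r` by its central difference, at the price of two degrees; the alternating
-- sign turns the coefficients -1, 2, -1 into 1, 2, 1. Evenness survives each round and supplies the
-- value at -1 needed for folding at 0.
iterate-σ-vanishes : ∀ M {r : ℤ → ℤ} {e : ℕ → ℤ} → Even r → PolyDegree< (M ℕ.* 2) r →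
                     (∀ k → e k ≡ altSign k * r (+ k)) → ∀ k → iterate-σ M e k ≡ 0ℤ
iterate-σ-vanishes zero    {r} even p e≡ k =
  trans (e≡ k) (trans (cong (altSign k *_) (p (+ k))) (ℤ.*-zeroʳ (altSign k)))
iterate-σ-vanishes (suc M) {r} {e} even p e≡ =
  iterate-σ-vanishes M (even-centralDifference even) (poly-centralDifference (M ℕ.* 2) {r} p) σe≡
  where
  at0 : ∀ a b → (1ℤ * a + 1ℤ * a) + (- 1ℤ * b + - 1ℤ * b) ≡ 1ℤ * ((a + a) - b - b)
  at0 = solve-∀
  at : ∀ s a b c → s * a + (- s * b + - s * b) + - (- s) * c ≡ - s * ((b + b) - c - a)
  at = solve-∀
  σe≡ : ∀ k → σ e k ≡ altSign k * centralDifference r (+ k)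
  σe≡ zero    = trans (cong₂ (λ a b → (a + a) + (b + b)) (e≡ 0) (e≡ 1))
    (trans (at0 (r 0ℤ) (r 1ℤ)) (cong (λ a → 1ℤ * ((r 0ℤ + r 0ℤ) - r 1ℤ - a)) (sym (even 1ℤ))))
  σe≡ (suc k) = trans
    (cong₂ _+_ (cong₂ (λ a b → a + (b + b)) (e≡ k) (e≡ (suc k))) (e≡ (suc (suc k))))
    (at (altSign k) (r (+ k)) (r (+ suc k)) (r (+ suc (suc k))))

-- weight M k is the central binomial coefficient (2M choose M+k).
weight : ℕ → ℕ → ℕ
weight zero    zero    = 1
weight zero    (suc k) = 0
weight (suc M) zero    = (weight M 0 ℕ.+ weight M 0) ℕ.+ (weight M 1 ℕ.+ weight M 1)
weight (suc M) (suc k) = weight M k ℕ.+ (weight M (suc k) ℕ.+ weight M (suc k)) ℕ.+ weight M (suc (suc k))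

weight-support : ∀ M {k} → M < k → weight M k ≡ 0
weight-support zero    {suc k} _ = refl
weight-support (suc M) {suc k} (s≤s M<k)
  rewrite weight-support M M<k | weight-support M (ℕ.m<n⇒m<1+n M<k)
        | weight-support M (ℕ.m<n⇒m<1+n (ℕ.m<n⇒m<1+n M<k)) = refl

weight-antitone : ∀ M k → weight M (suc k) ≤ weight M k
weight-antitone zero    k       = z≤n
weight-antitone (suc M) zero    = begin
  w 0 ℕ.+ (w 1 ℕ.+ w 1) ℕ.+ w 2           ≤⟨ ℕ.+-monoʳ-≤ _ (ℕ.≤-trans (weight-antitone M 1) (weight-antitone M 0)) ⟩
  w 0 ℕ.+ (w 1 ℕ.+ w 1) ℕ.+ w 0           ≡⟨ regroup (w 0) (w 1) ⟩
  (w 0 ℕ.+ w 0) ℕ.+ (w 1 ℕ.+ w 1)         ∎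
  where
  open ℕ.≤-Reasoning
  w = weight M
  regroup : ∀ a b → a ℕ.+ (b ℕ.+ b) ℕ.+ a ≡ (a ℕ.+ a) ℕ.+ (b ℕ.+ b)
  regroup = ℕRing.solve-∀
weight-antitone (suc M) (suc k) =
  ℕ.+-mono-≤ (ℕ.+-mono-≤ (weight-antitone M k) (ℕ.+-mono-≤ (weight-antitone M (suc k)) (weight-antitone M (suc k))))
             (weight-antitone M (suc (suc k)))

weight≤weight₀ : ∀ M k → weight M k ≤ weight M 0
weight≤weight₀ M zero    = ℕ.≤-refl
weight≤weight₀ M (suc k) = ℕ.≤-trans (weight-antitone M k) (weight≤weight₀ M k)

weight₀>0 : ∀ M → 0 < weight M 0
weight₀>0 zero    = s≤s z≤n
weight₀>0 (suc M) = ℕ.≤-trans (weight₀>0 M) (ℕ.≤-trans (ℕ.m≤m+n _ _) (ℕ.m≤m+n _ _))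

-- The pairing Σ w(k) e(k) over |k| ≤ K of two even sequences.
pairing : ℕ → (ℕ → ℤ) → (ℕ → ℤ) → ℤ
pairing zero    w e = w 0 * e 0
pairing (suc K) w e = pairing K w e + (w (suc K) * e (suc K) + w (suc K) * e (suc K))

-- Summation by parts: the stencil 1, 2, 1 is symmetric, hence self-adjoint up to terms at the
-- cut-off `K`.
pairing-σ : ∀ K w e → pairing K w (σ e) ≡
            pairing K (σ w) e + (+ 2 * (w K * e (suc K)) - + 2 * (w (suc K) * e K))
pairing-σ zero    w e = base (w 0) (w 1) (e 0) (e 1)
  where
  base : ∀ w₀ w₁ e₀ e₁ → w₀ * ((e₀ + e₀) + (e₁ + e₁)) ≡
         ((w₀ + w₀) + (w₁ + w₁)) * e₀ + (+ 2 * (w₀ * e₁) - + 2 * (w₁ * e₀))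
  base = solve-∀
pairing-σ (suc K) w e = trans
  (cong (λ z → z + (w (suc K) * σ e (suc K) + w (suc K) * σ e (suc K))) (pairing-σ K w e))
  (step (pairing K (σ w) e) (w K) (w (suc K)) (w (suc (suc K))) (e K) (e (suc K)) (e (suc (suc K))))
  where
  step : ∀ p w₀ w₁ w₂ e₀ e₁ e₂ →
    p + (+ 2 * (w₀ * e₁) - + 2 * (w₁ * e₀)) + (w₁ * (e₀ + (e₁ + e₁) + e₂) + w₁ * (e₀ + (e₁ + e₁) + e₂)) ≡
    p + ((w₀ + (w₁ + w₁) + w₂) * e₁ + (w₀ + (w₁ + w₁) + w₂) * e₁) + (+ 2 * (w₁ * e₂) - + 2 * (w₂ * e₁))
  step = solve-∀

pairing-cong : ∀ K {w w′ : ℕ → ℤ} e → w ≗ w′ → pairing K w e ≡ pairing K w′ e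
pairing-cong zero    e w≗ = cong (_* e 0) (w≗ 0)
pairing-cong (suc K) e w≗ =
  cong₂ (λ p a → p + (a * e (suc K) + a * e (suc K))) (pairing-cong K e w≗) (w≗ (suc K))

weight-suc : ∀ M k → + weight (suc M) k ≡ σ (λ k → + weight M k) k
weight-suc M zero    = refl
weight-suc M (suc k) = refl

-- The weights arise by applying `σ` to the point mass at 0, so the applications can be moved one at
-- a time onto `e`. The boundary terms vanish because `weight M` is zero beyond `M`.
pairing-weight : ∀ M {K} e → M ≤ K → pairing K (λ k → + weight M k) e ≡ iterate-σ M e 0
pairing-weight zero    {zero}  e _ = ℤ.*-identityˡ (e 0)
pairing-weight zero    {suc K} e _ = trans
  (cong₂ _+_ (pairing-weight zero {K} e z≤n) (zeros (e (suc K)))) (ℤ.+-identityʳ (e 0))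
  where
  zeros : ∀ a → 0ℤ * a + 0ℤ * a ≡ 0ℤ
  zeros = solve-∀
pairing-weight (suc M) {K} e M<K = begin
  pairing K (λ k → + weight (suc M) k) e
    ≡⟨ pairing-cong K e (weight-suc M) ⟩
  pairing K (σ w) e
    ≡⟨ no-boundary (pairing K (σ w) e) (e (suc K)) (e K) ⟩
  pairing K (σ w) e + (+ 2 * (0ℤ * e (suc K)) - + 2 * (0ℤ * e K))
    ≡⟨ cong₂ (λ a b → pairing K (σ w) e + (+ 2 * (a * e (suc K)) - + 2 * (b * e K)))
             (cong +_ (weight-support M M<K)) (cong +_ (weight-support M (ℕ.m<n⇒m<1+n M<K))) ⟨
  pairing K (σ w) e + (+ 2 * (w K * e (suc K)) - + 2 * (w (suc K) * e K))
    ≡⟨ pairing-σ K w e ⟨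
  pairing K w (σ e)
    ≡⟨ pairing-weight M (σ e) (ℕ.<⇒≤ M<K) ⟩
  iterate-σ M (σ e) 0 ∎
  where
  open ≡-Reasoning
  w : ℕ → ℤ
  w k = + weight M k
  no-boundary : ∀ p a b → p ≡ p + (+ 2 * (0ℤ * a) - + 2 * (0ℤ * b))
  no-boundary = solve-∀

pairing-bound : ∀ K (w : ℕ → ℕ) e W B → (∀ k → w k ≤ W) → (∀ k → suc k ≤ K → ∣ e (suc k) ∣ ≤ B) →
  ∣ + w 0 * e 0 ∣ ≤ ∣ pairing K (λ k → + w k) e ∣ ℕ.+ K ℕ.* (W ℕ.* B ℕ.+ W ℕ.* B)
pairing-bound zero    w e W B w≤W e≤B = ℕ.m≤m+n _ 0
pairing-bound (suc K) w e W B w≤W e≤B = begin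
  ∣ + w 0 * e 0 ∣
    ≤⟨ pairing-bound K w e W B w≤W (λ k k<K → e≤B k (ℕ.m≤n⇒m≤1+n k<K)) ⟩
  ∣ p ∣ ℕ.+ K ℕ.* T
    ≡⟨ cong (λ z → ∣ z ∣ ℕ.+ K ℕ.* T) (add-sub p t) ⟩
  ∣ (p + (t + t)) - (t + t) ∣ ℕ.+ K ℕ.* T
    ≤⟨ ℕ.+-monoˡ-≤ _ (ℤ.∣i-j∣≤∣i∣+∣j∣ (p + (t + t)) (t + t)) ⟩
  (∣ p + (t + t) ∣ ℕ.+ ∣ t + t ∣) ℕ.+ K ℕ.* T
    ≡⟨ ℕ.+-assoc ∣ p + (t + t) ∣ _ _ ⟩
  ∣ p + (t + t) ∣ ℕ.+ (∣ t + t ∣ ℕ.+ K ℕ.* T)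
    ≤⟨ ℕ.+-monoʳ-≤ ∣ p + (t + t) ∣ (ℕ.+-monoˡ-≤ (K ℕ.* T)
         (ℕ.≤-trans (ℤ.∣i+j∣≤∣i∣+∣j∣ t t) (ℕ.+-mono-≤ ∣t∣≤ ∣t∣≤))) ⟩
  ∣ p + (t + t) ∣ ℕ.+ (T ℕ.+ K ℕ.* T) ∎
  where
  open ℕ.≤-Reasoning
  p = pairing K (λ k → + w k) e
  t = + w (suc K) * e (suc K)
  T = W ℕ.* B ℕ.+ W ℕ.* B
  add-sub : ∀ p t → p ≡ (p + (t + t)) - (t + t)
  add-sub = solve-∀
  ∣t∣≤ : ∣ t ∣ ≤ W ℕ.* B
  ∣t∣≤ = ℕ.≤-trans (ℕ.≤-reflexive (ℤ.∣i*j∣≡∣i∣*∣j∣ (+ w (suc K)) (e (suc K))))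
                   (ℕ.*-mono-≤ (w≤W (suc K)) (e≤B K ℕ.≤-refl))

∣altSign*∣ : ∀ k i → ∣ altSign k * i ∣ ≡ ∣ i ∣
∣altSign*∣ zero    i = cong ∣_∣ (ℤ.*-identityˡ i)
∣altSign*∣ (suc k) i = trans (cong ∣_∣ (sym (ℤ.neg-distribˡ-* (altSign k) i)))
  (trans (ℤ.∣-i∣≡∣i∣ (altSign k * i)) (∣altSign*∣ k i))

-- The weighted sum is zero, so its central term is balanced by the `M` mirrored pairs. Bounding
-- every weight by the central one lets the binomials cancel, leaving a factor linear in `M`.
even-poly-bound : ∀ M {r : ℤ → ℤ} B → Even r → PolyDegree< (M ℕ.* 2) r →
  (∀ k → suc k ≤ M → ∣ r (+ suc k) ∣ ≤ B) → ∣ r 0ℤ ∣ ≤ M ℕ.* (B ℕ.+ B)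
even-poly-bound M {r} B even p r≤B = ℕ.*-cancelˡ-≤ W {{ℕ.>-nonZero (weight₀>0 M)}} (begin
  W ℕ.* ∣ r 0ℤ ∣             ≡⟨ cong (W ℕ.*_) (∣altSign*∣ 0 (r 0ℤ)) ⟨
  W ℕ.* ∣ e 0 ∣              ≡⟨ ℤ.∣i*j∣≡∣i∣*∣j∣ (+ W) (e 0) ⟨
  ∣ + W * e 0 ∣              ≤⟨ pairing-bound M (weight M) e W B (weight≤weight₀ M) e≤B ⟩
  ∣ pairing M (λ k → + weight M k) e ∣ ℕ.+ M ℕ.* (W ℕ.* B ℕ.+ W ℕ.* B)
                             ≡⟨ cong (λ z → ∣ z ∣ ℕ.+ M ℕ.* (W ℕ.* B ℕ.+ W ℕ.* B)) pairing≡0 ⟩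
  M ℕ.* (W ℕ.* B ℕ.+ W ℕ.* B) ≡⟨ regroup M W B ⟩
  W ℕ.* (M ℕ.* (B ℕ.+ B))    ∎)
  where
  open ℕ.≤-Reasoning
  W = weight M 0
  e : ℕ → ℤ
  e k = altSign k * r (+ k)
  e≤B : ∀ k → suc k ≤ M → ∣ e (suc k) ∣ ≤ B
  e≤B k k<M = ℕ.≤-trans (ℕ.≤-reflexive (∣altSign*∣ (suc k) (r (+ suc k)))) (r≤B k k<M)
  pairing≡0 : pairing M (λ k → + weight M k) e ≡ 0ℤ
  pairing≡0 = trans (pairing-weight M e ℕ.≤-refl) (iterate-σ-vanishes M even p (λ _ → refl) 0)
  regroup : ∀ m w b → m ℕ.* (w ℕ.* b ℕ.+ w ℕ.* b) ≡ w ℕ.* (m ℕ.* (b ℕ.+ b))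
  regroup = ℕRing.solve-∀

-- Expectations under product measures

-- expectation c a g is c ^ b times the expectation of g when each of the b bits
-- is independently true with probability a / c.
expectation : ∀ {b} → ℤ → ℤ → (Input b → ℤ) → ℤ
expectation {zero}  c a g = g []
expectation {suc b} c a g = (c - a) * expectation c a (g ∘ (false ∷_)) + a * expectation c a (g ∘ (true ∷_))

expectation-- : ∀ {b} c a (g h : Input b → ℤ) →
                expectation c a (λ y → g y - h y) ≡ expectation c a g - expectation c a h
expectation-- {zero}  c a g h = refl
expectation-- {suc b} c a g h = trans
  (cong₂ (λ p q → (c - a) * p + a * q) (expectation-- c a (g ∘ (false ∷_)) (h ∘ (false ∷_)))
                                       (expectation-- c a (g ∘ (true ∷_)) (h ∘ (true ∷_))))
  (regroup (c - a) a (expectation c a (g ∘ (false ∷_))) (expectation c a (h ∘ (false ∷_)))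
                     (expectation c a (g ∘ (true ∷_))) (expectation c a (h ∘ (true ∷_))))
  where
  regroup : ∀ d a p p′ q q′ → d * (p - p′) + a * (q - q′) ≡ (d * p + a * q) - (d * p′ + a * q′)
  regroup = solve-∀

expectation-0 : ∀ {b} c a {g : Input b → ℤ} → (∀ y → g y ≡ 0ℤ) → expectation c a g ≡ 0ℤ
expectation-0 {zero}  c a g≡0 = g≡0 []
expectation-0 {suc b} c a g≡0 = trans
  (cong₂ (λ p q → (c - a) * p + a * q) (expectation-0 c a (g≡0 ∘ (false ∷_))) (expectation-0 c a (g≡0 ∘ (true ∷_))))
  (cong₂ _+_ (ℤ.*-zeroʳ (c - a)) (ℤ.*-zeroʳ a))

derivative : ∀ {b} → (Input (suc b) → ℤ) → Input b → ℤ
derivative g y = g (true ∷ y) - g (false ∷ y)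

expectation-derivative : ∀ {b} c a (g : Input (suc b) → ℤ) → expectation c a g ≡
  c * expectation c a (g ∘ (false ∷_)) + a * expectation c a (derivative g)
expectation-derivative c a g = trans
  (regroup c a (expectation c a (g ∘ (false ∷_))) (expectation c a (g ∘ (true ∷_))))
  (cong (λ z → c * expectation c a (g ∘ (false ∷_)) + a * z)
        (sym (expectation-- c a (g ∘ (true ∷_)) (g ∘ (false ∷_)))))
  where
  regroup : ∀ c a p q → (c - a) * p + a * q ≡ c * p + a * (q - p)
  regroup = solve-∀

-- (expectation c a g - expectation c 0 g) / a
quotient : ∀ {b} → ℤ → ℤ → (Input b → ℤ) → ℤ
quotient {zero}  c a g = 0ℤ
quotient {suc b} c a g = c * quotient c a (g ∘ (false ∷_)) + expectation c a (derivative g)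

-- The recursion for `quotient` performs no division, so `quotient` also has a value at `a = 0`,
-- where it is a scaled derivative.
expectation-quotient : ∀ {b} c a (g : Input b → ℤ) →
                       expectation c a g ≡ c ℤ.^ b * g ⊥ + a * quotient c a g
expectation-quotient {zero}  c a g = base a (g [])
  where
  base : ∀ a p → p ≡ 1ℤ * p + a * 0ℤ
  base = solve-∀
expectation-quotient {suc b} c a g = begin
  expectation c a g
    ≡⟨ expectation-derivative c a g ⟩
  c * expectation c a (g ∘ (false ∷_)) + a * expectation c a (derivative g)
    ≡⟨ cong (λ z → c * z + a * expectation c a (derivative g)) (expectation-quotient c a (g ∘ (false ∷_))) ⟩
  c * (c ℤ.^ b * g ⊥ + a * quotient c a (g ∘ (false ∷_))) + a * expectation c a (derivative g)
    ≡⟨ regroup c (c ℤ.^ b) (g ⊥) a (quotient c a (g ∘ (false ∷_))) (expectation c a (derivative g)) ⟩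
  c * c ℤ.^ b * g ⊥ + a * (c * quotient c a (g ∘ (false ∷_)) + expectation c a (derivative g)) ∎
  where
  open ≡-Reasoning
  regroup : ∀ c d p a q e → c * (d * p + a * q) + a * e ≡ c * d * p + a * (c * q + e)
  regroup = solve-∀

-- Each variable of a monomial contributes a factor `x * x`, which doubles the degree.
expectation-poly : ∀ {b} D c (g : Input b → ℤ) → Degree< D g →
                   PolyDegree< (D ℕ.* 2) (λ x → expectation c (x * x) g)
expectation-poly zero            c g deg x = expectation-0 c (x * x) deg
expectation-poly {zero}  (suc D) c g deg   = poly-const (suc (D ℕ.* 2)) (g [])
expectation-poly {suc b} (suc D) c g (deg₀ , degΔ) =
  poly-resp n (λ x → trans (cong (λ z → c * expectation c (x * x) (g ∘ (false ∷_)) + z)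
                                 (sym (ℤ.*-assoc x x (expectation c (x * x) (derivative g)))))
                           (sym (expectation-derivative c (x * x) g)))
    (poly-+ n {λ x → c * r x} {λ x → x * (x * t x)}
      (poly-scale n {r} c (expectation-poly (suc D) c (g ∘ (false ∷_)) deg₀))
      (poly-x* (suc (D ℕ.* 2)) {λ x → x * t x}
        (poly-x* (D ℕ.* 2) {t} (expectation-poly D c (derivative g) degΔ))))
  where
  n = suc D ℕ.* 2
  r t : ℤ → ℤ
  r x = expectation c (x * x) (g ∘ (false ∷_))
  t x = expectation c (x * x) (derivative g)

quotient-poly : ∀ {b} D c (g : Input b → ℤ) → Degree< (suc D) g →
                PolyDegree< (D ℕ.* 2) (λ x → quotient c (x * x) g)
quotient-poly {zero}  D c g deg = poly-0 (D ℕ.* 2)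
quotient-poly {suc b} D c g (deg₀ , degΔ) =
  poly-+ (D ℕ.* 2) {λ x → c * quotient c (x * x) (g ∘ (false ∷_))} {λ x → expectation c (x * x) (derivative g)}
    (poly-scale (D ℕ.* 2) {λ x → quotient c (x * x) (g ∘ (false ∷_))} c (quotient-poly D c (g ∘ (false ∷_)) deg₀))
    (expectation-poly D c (derivative g) degΔ)

∣expectation∣≤ : ∀ {b} c a (g : Input b → ℤ) → a ≤ c → (∀ y → ∣ g y ∣ ≤ 1) →
                 ∣ expectation (+ c) (+ a) g ∣ ≤ c ℕ.^ b
∣expectation∣≤ {zero}  c a g a≤c g≤1 = g≤1 []
∣expectation∣≤ {suc b} c a g a≤c g≤1 = begin
  ∣ (+ c - + a) * p + + a * q ∣
    ≤⟨ ℤ.∣i+j∣≤∣i∣+∣j∣ ((+ c - + a) * p) (+ a * q) ⟩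
  ∣ (+ c - + a) * p ∣ ℕ.+ ∣ + a * q ∣
    ≡⟨ cong₂ ℕ._+_ (ℤ.∣i*j∣≡∣i∣*∣j∣ (+ c - + a) p) (ℤ.∣i*j∣≡∣i∣*∣j∣ (+ a) q) ⟩
  ∣ + c - + a ∣ ℕ.* ∣ p ∣ ℕ.+ a ℕ.* ∣ q ∣
    ≡⟨ cong (λ z → ∣ z ∣ ℕ.* ∣ p ∣ ℕ.+ a ℕ.* ∣ q ∣) (trans (ℤ.m-n≡m⊖n c a) (ℤ.⊖-≥ a≤c)) ⟩
  (c ℕ.∸ a) ℕ.* ∣ p ∣ ℕ.+ a ℕ.* ∣ q ∣
    ≤⟨ ℕ.+-mono-≤ (ℕ.*-monoʳ-≤ (c ℕ.∸ a) (∣expectation∣≤ c a (g ∘ (false ∷_)) a≤c (g≤1 ∘ (false ∷_))))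
                  (ℕ.*-monoʳ-≤ a (∣expectation∣≤ c a (g ∘ (true ∷_)) a≤c (g≤1 ∘ (true ∷_)))) ⟩
  (c ℕ.∸ a) ℕ.* c ℕ.^ b ℕ.+ a ℕ.* c ℕ.^ b
    ≡⟨ ℕ.*-distribʳ-+ (c ℕ.^ b) (c ℕ.∸ a) a ⟨
  (c ℕ.∸ a ℕ.+ a) ℕ.* c ℕ.^ b
    ≡⟨ cong (ℕ._* c ℕ.^ b) (ℕ.m∸n+n≡m a≤c) ⟩
  c ℕ.* c ℕ.^ b ∎
  where
  open ℕ.≤-Reasoning
  p = expectation (+ c) (+ a) (g ∘ (false ∷_))
  q = expectation (+ c) (+ a) (g ∘ (true ∷_))

^-pos : ∀ c b → (+ c) ℤ.^ b ≡ + (c ℕ.^ b)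
^-pos c zero    = refl
^-pos c (suc b) = trans (cong (+ c *_) (^-pos c b)) (sym (ℤ.pos-* c (c ℕ.^ b)))

-- Since `a` is a positive integer, dividing by it cannot enlarge the difference of two quantities
-- that are each at most `c ^ b`.
∣quotient∣≤ : ∀ {b} c a (g : Input b → ℤ) → 0 < a → a ≤ c → (∀ y → ∣ g y ∣ ≤ 1) →
              ∣ quotient (+ c) (+ a) g ∣ ≤ c ℕ.^ b ℕ.+ c ℕ.^ b
∣quotient∣≤ {b} c a g 0<a a≤c g≤1 = begin
  ∣ q ∣                        ≤⟨ ℕ.m≤n*m ∣ q ∣ a {{ℕ.>-nonZero 0<a}} ⟩
  a ℕ.* ∣ q ∣                  ≡⟨ ℤ.∣i*j∣≡∣i∣*∣j∣ (+ a) q ⟨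
  ∣ + a * q ∣                  ≡⟨ cong ∣_∣ (add-sub (p₀) (+ a * q)) ⟩
  ∣ (p₀ + + a * q) - p₀ ∣      ≡⟨ cong (λ z → ∣ z - p₀ ∣) (expectation-quotient (+ c) (+ a) g) ⟨
  ∣ expectation (+ c) (+ a) g - p₀ ∣
                               ≤⟨ ℤ.∣i-j∣≤∣i∣+∣j∣ (expectation (+ c) (+ a) g) p₀ ⟩
  ∣ expectation (+ c) (+ a) g ∣ ℕ.+ ∣ p₀ ∣
                               ≤⟨ ℕ.+-mono-≤ (∣expectation∣≤ c a g a≤c g≤1) ∣p₀∣≤ ⟩
  c ℕ.^ b ℕ.+ c ℕ.^ b          ∎
  where
  open ℕ.≤-Reasoning
  q = quotient (+ c) (+ a) g
  p₀ = (+ c) ℤ.^ b * g ⊥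
  add-sub : ∀ p t → t ≡ (p + t) - p
  add-sub = solve-∀
  ∣p₀∣≤ : ∣ p₀ ∣ ≤ c ℕ.^ b
  ∣p₀∣≤ = begin
    ∣ p₀ ∣                         ≡⟨ ℤ.∣i*j∣≡∣i∣*∣j∣ ((+ c) ℤ.^ b) (g ⊥) ⟩
    ∣ (+ c) ℤ.^ b ∣ ℕ.* ∣ g ⊥ ∣    ≡⟨ cong (λ z → ∣ z ∣ ℕ.* ∣ g ⊥ ∣) (^-pos c b) ⟩
    c ℕ.^ b ℕ.* ∣ g ⊥ ∣            ≤⟨ ℕ.*-monoʳ-≤ (c ℕ.^ b) (g≤1 ⊥) ⟩
    c ℕ.^ b ℕ.* 1                  ≡⟨ ℕ.*-identityʳ _ ⟩
    c ℕ.^ b                        ∎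

-- To first order in the flip probability only the empty set and the singletons matter. The factor
-- `c` on the left avoids the exponent `b - 1`.
quotient-at-0 : ∀ {b} c (g : Input b → ℤ) u v → g ⊥ ≡ u → (∀ j → g ⁅ j ⁆ ≡ v) →
                c * quotient c 0ℤ g ≡ + b * c ℤ.^ b * (v - u)
quotient-at-0 {zero}  c g u v g⊥ g⁅⁆ = base c (v - u)
  where
  base : ∀ c d → c * 0ℤ ≡ 0ℤ * 1ℤ * d
  base = solve-∀
quotient-at-0 {suc b} c g u v g⊥ g⁅⁆ = begin
  c * (c * q₀ + expectation c 0ℤ (derivative g))
    ≡⟨ cong₂ (λ y z → c * (y + z)) (quotient-at-0 c (g ∘ (false ∷_)) u v g⊥ (g⁅⁆ ∘ suc))
             (expectation-quotient c 0ℤ (derivative g)) ⟩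
  c * (+ b * c ℤ.^ b * (v - u) + (c ℤ.^ b * derivative g ⊥ + 0ℤ * quotient c 0ℤ (derivative g)))
    ≡⟨ cong₂ (λ y z → c * (+ b * c ℤ.^ b * (v - u) + (c ℤ.^ b * (y - z) + 0ℤ * quotient c 0ℤ (derivative g))))
             (g⁅⁆ zero) g⊥ ⟩
  c * (+ b * c ℤ.^ b * (v - u) + (c ℤ.^ b * (v - u) + 0ℤ * quotient c 0ℤ (derivative g)))
    ≡⟨ collect c (+ b) (c ℤ.^ b) (v - u) (quotient c 0ℤ (derivative g)) ⟩
  (1ℤ + + b) * (c * c ℤ.^ b) * (v - u) ∎
  where
  open ≡-Reasoning
  q₀ = quotient c 0ℤ (g ∘ (false ∷_))
  collect : ∀ c b p d q → c * (b * p * d + (p * d + 0ℤ * q)) ≡ (1ℤ + b) * (c * p) * d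
  collect = solve-∀

-- Compares the slope b |v - u| of the expectation at probability 0 with its
-- values at the probabilities x² / c, 1 ≤ x ≤ M.
fully-sensitive-bound : ∀ {b} M c (g : Input b → ℤ) u v → 0 < c → M ℕ.* M ≤ c → Degree< (suc M) g →
  (∀ y → ∣ g y ∣ ≤ 1) → g ⊥ ≡ u → (∀ j → g ⁅ j ⁆ ≡ v) → ∣ v - u ∣ ≡ 2 → b ≤ 2 ℕ.* (c ℕ.* M)
fully-sensitive-bound {b} M c g u v 0<c M²≤c deg g≤1 g⊥ g⁅⁆ gap =
  ℕ.*-cancelʳ-≤ b (2 ℕ.* (c ℕ.* M)) P {{P≢0}} (ℕ.*-cancelʳ-≤ _ _ 2 (begin
    b ℕ.* P ℕ.* 2
      ≡⟨ cong (b ℕ.* P ℕ.*_) gap ⟨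
    b ℕ.* P ℕ.* ∣ v - u ∣
      ≡⟨ cong (ℕ._* ∣ v - u ∣) (trans (ℤ.∣i*j∣≡∣i∣*∣j∣ (+ b) ((+ c) ℤ.^ b))
                                       (cong (λ z → b ℕ.* ∣ z ∣) (^-pos c b))) ⟨
    ∣ + b * (+ c) ℤ.^ b ∣ ℕ.* ∣ v - u ∣
      ≡⟨ ℤ.∣i*j∣≡∣i∣*∣j∣ (+ b * (+ c) ℤ.^ b) (v - u) ⟨
    ∣ + b * (+ c) ℤ.^ b * (v - u) ∣
      ≡⟨ cong ∣_∣ (quotient-at-0 (+ c) g u v g⊥ g⁅⁆) ⟨
    ∣ + c * quotient (+ c) 0ℤ g ∣
      ≡⟨ ℤ.∣i*j∣≡∣i∣*∣j∣ (+ c) (quotient (+ c) 0ℤ g) ⟩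
    c ℕ.* ∣ quotient (+ c) 0ℤ g ∣
      ≤⟨ ℕ.*-monoʳ-≤ c (even-poly-bound M (P ℕ.+ P) even (quotient-poly M (+ c) g deg) nodes) ⟩
    c ℕ.* (M ℕ.* ((P ℕ.+ P) ℕ.+ (P ℕ.+ P)))
      ≡⟨ regroup c M P ⟩
    2 ℕ.* (c ℕ.* M) ℕ.* P ℕ.* 2 ∎))
  where
  open ℕ.≤-Reasoning
  P = c ℕ.^ b
  P≢0 : ℕ.NonZero P
  P≢0 = ℕ.m^n≢0 c b {{ℕ.>-nonZero 0<c}}
  square-neg : ∀ x → - x * - x ≡ x * x
  square-neg = solve-∀
  even : Even (λ x → quotient (+ c) (x * x) g)
  even x = cong (λ a → quotient (+ c) a g) (square-neg x)
  -- `M * M ≤ c` makes every node x² / c a probability.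
  nodes : ∀ k → suc k ≤ M → ∣ quotient (+ c) (+ suc k * + suc k) g ∣ ≤ P ℕ.+ P
  nodes k k<M = subst (λ a → ∣ quotient (+ c) a g ∣ ≤ P ℕ.+ P) (ℤ.pos-* (suc k) (suc k))
    (∣quotient∣≤ c (suc k ℕ.* suc k) g (s≤s z≤n) (ℕ.≤-trans (ℕ.*-mono-≤ k<M k<M) M²≤c) g≤1)
  regroup : ∀ c m p → c ℕ.* (m ℕ.* ((p ℕ.+ p) ℕ.+ (p ℕ.+ p))) ≡ 2 ℕ.* (c ℕ.* m) ℕ.* p ℕ.* 2
  regroup = ℕRing.solve-∀

-- The polynomial bound and its comparison with 2 ^ s

∣sgn∣ : ∀ b → ∣ sgn b ∣ ≡ 1
∣sgn∣ true  = refl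
∣sgn∣ false = refl

sgn-gap : ∀ b → ∣ sgn (not b) - sgn b ∣ ≡ 2
sgn-gap true  = refl
sgn-gap false = refl

⊥-^ : ∀ {n} (p : Subset n) → ⊥ ^ p ≡ p
⊥-^ []      = refl
⊥-^ (b ∷ p) = cong (b ∷_) (⊥-^ p)

bs-at≤poly : ∀ {n} (f : BooleanFunction n) x → bs-at f x ≤ 2 ℕ.* suc (s f) ℕ.^ 6
bs-at≤poly f x with bs-at-exists f x
... | b , isMax with IsMaximum.attained isMax
... | Bs , disjoint , sens = begin
  b                       ≤⟨ fully-sensitive-bound M K² g u v (s≤s z≤n) M²≤K² degree g≤1 g⊥ g⁅⁆ (sgn-gap (f x)) ⟩
  2 ℕ.* (K² ℕ.* M)        ≤⟨ ℕ.*-monoʳ-≤ 2 (ℕ.*-monoʳ-≤ K² (ℕ.n≤1+n M)) ⟩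
  2 ℕ.* (K² ℕ.* suc M)    ≡⟨ cong (2 ℕ.*_) (sixth (suc (s f))) ⟩
  2 ℕ.* suc (s f) ℕ.^ 6   ∎
  where
  open ℕ.≤-Reasoning
  -- Chosen so that `suc M` is definitionally `suc (s f) * suc (s f)`, the order at which
  -- differences of `f` vanish.
  M = s f ℕ.+ s f ℕ.* suc (s f)
  K² = suc M ℕ.* suc M
  u = sgn (f x)
  v = sgn (not (f x))
  g : Input b → ℤ
  g y = sgn (f (flipBlocks Bs y x))
  M²≤K² : M ℕ.* M ≤ K²
  M²≤K² = ℕ.*-mono-≤ (ℕ.n≤1+n M) (ℕ.n≤1+n M)
  degree : Degree< (suc M) g
  degree = degree-on-blocks (suc M) {F = sgn ∘ f} Bs disjoint (λ _ _ → tt)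
             (s<k⇒Vanishes {k = suc (s f)} f ℕ.≤-refl) x
  g≤1 : ∀ y → ∣ g y ∣ ≤ 1
  g≤1 y = ℕ.≤-reflexive (∣sgn∣ (f (flipBlocks Bs y x)))
  g⊥ : g ⊥ ≡ u
  g⊥ = cong (sgn ∘ f) (flipBlocks-⊥ Bs x)
  g⁅⁆ : ∀ j → g ⁅ j ⁆ ≡ v
  g⁅⁆ j = trans
    (cong (sgn ∘ f) (trans (cong (λ y → flipBlocks Bs y x) (sym (⊥-^ ⁅ j ⁆)))
                    (trans (flipBlocks-flip Bs ⊥ j x) (cong (_^ lookup Bs j) (flipBlocks-⊥ Bs x)))))
    (cong sgn (¬-not (sens j ∘ sym)))
  sixth : ∀ a → a ℕ.* a ℕ.* (a ℕ.* a) ℕ.* (a ℕ.* a) ≡ a ℕ.* (a ℕ.* (a ℕ.* (a ℕ.* (a ℕ.* (a ℕ.* 1)))))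
  sixth = ℕRing.solve-∀

C≤poly : ∀ {n} (f : BooleanFunction n) → C f ≤ 2 ℕ.* suc (s f) ℕ.^ 6 ℕ.* s f
C≤poly f = max-over-inputs-≤ (C-at f) λ x →
  ℕ.≤-trans (C-at≤bs*s f x) (ℕ.*-monoˡ-≤ (s f) (bs-at≤poly f x))

-- Fractions and the null sequence

toℚᵘ-/ : ∀ i d → ℚ.toℚᵘ (i / suc d) ℚᵘ.≃ ℚᵘ.mkℚᵘ i d
toℚᵘ-/ i d = ℚ.toℚᵘ-fromℚᵘ (ℚᵘ.mkℚᵘ i d)

/-mono-≤ : ∀ a b d e .{{_ : ℕ.NonZero d}} .{{_ : ℕ.NonZero e}} → a ℕ.* e ≤ b ℕ.* d → + a / d ℚ.≤ + b / e
/-mono-≤ a b (suc d) (suc e) ae≤bd = ℚ.toℚᵘ-cancel-≤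
  (ℚᵘ.≤-respˡ-≃ (ℚᵘ.≃-sym (toℚᵘ-/ (+ a) d)) (ℚᵘ.≤-respʳ-≃ (ℚᵘ.≃-sym (toℚᵘ-/ (+ b) e))
    (ℚᵘ.*≤* (subst₂ ℤ._≤_ (ℤ.pos-* a (suc e)) (ℤ.pos-* b (suc d)) (ℤ.+≤+ ae≤bd)))))

/-mono-< : ∀ a b d e .{{_ : ℕ.NonZero d}} .{{_ : ℕ.NonZero e}} → a ℕ.* e < b ℕ.* d → + a / d ℚ.< + b / e
/-mono-< a b (suc d) (suc e) ae<bd = ℚ.toℚᵘ-cancel-<
  (ℚᵘ.<-respˡ-≃ (ℚᵘ.≃-sym (toℚᵘ-/ (+ a) d)) (ℚᵘ.<-respʳ-≃ (ℚᵘ.≃-sym (toℚᵘ-/ (+ b) e))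
    (ℚᵘ.*<* (subst₂ ℤ._<_ (ℤ.pos-* a (suc e)) (ℤ.pos-* b (suc d)) (ℤ.+<+ ae<bd)))))

/-* : ∀ a b d e .{{_ : ℕ.NonZero d}} .{{_ : ℕ.NonZero e}} →
      (+ a / d) ℚ.* (+ b / e) ≡ (+ (a ℕ.* b) / (d ℕ.* e)) {{ℕ.m*n≢0 d e}}
/-* a b (suc d) (suc e) = ℚ.toℚᵘ-injective (begin
  ℚ.toℚᵘ ((+ a / suc d) ℚ.* (+ b / suc e))         ≈⟨ ℚ.toℚᵘ-homo-* (+ a / suc d) (+ b / suc e) ⟩
  ℚ.toℚᵘ (+ a / suc d) ℚᵘ.* ℚ.toℚᵘ (+ b / suc e)   ≈⟨ ℚᵘ.*-cong (toℚᵘ-/ (+ a) d) (toℚᵘ-/ (+ b) e) ⟩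
  ℚᵘ.mkℚᵘ (+ a * + b) (e ℕ.+ d ℕ.* suc e)          ≡⟨ cong (λ i → ℚᵘ.mkℚᵘ i (e ℕ.+ d ℕ.* suc e)) (ℤ.pos-* a b) ⟨
  ℚᵘ.mkℚᵘ (+ (a ℕ.* b)) (e ℕ.+ d ℕ.* suc e)        ≈⟨ toℚᵘ-/ (+ (a ℕ.* b)) (e ℕ.+ d ℕ.* suc e) ⟨
  ℚ.toℚᵘ (+ (a ℕ.* b) / (suc d ℕ.* suc e))         ∎)
  where open ℚᵘ.≃-Reasoning

-- Of the factor 4, one 2 comes from the bound on block sensitivity and the other compensates the
-- denominator of `pow2-pred`.
error : ℕ → ℚ
error k = (+ (4 ℕ.* suc k ℕ.^ 6) / 2 ℕ.^ k) {{ℕ.m^n≢0 2 k}}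

n<2^n : ∀ n → n < 2 ℕ.^ n
n<2^n zero    = s≤s z≤n
n<2^n (suc n) = ℕ.+-mono-≤ (ℕ.m^n>0 2 n) (ℕ.≤-trans (n<2^n n) (ℕ.≤-reflexive (sym (ℕ.+-identityʳ _))))

poly<2^exponent : ∀ {p e k} q → p ≤ 2 ℕ.^ e → 2 ℕ.+ e ℕ.* 6 ℕ.+ q ≤ k → 4 ℕ.* p ℕ.^ 6 ℕ.* q < 2 ℕ.^ k
poly<2^exponent {p} {e} {k} q p≤ exponent≤k = begin-strict
  4 ℕ.* p ℕ.^ 6 ℕ.* q
    ≤⟨ ℕ.*-monoˡ-≤ q (ℕ.*-monoʳ-≤ 4 (ℕ.^-monoˡ-≤ 6 p≤)) ⟩
  4 ℕ.* (2 ℕ.^ e) ℕ.^ 6 ℕ.* q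
    ≡⟨ cong (λ z → 4 ℕ.* z ℕ.* q) (ℕ.^-*-assoc 2 e 6) ⟩
  4 ℕ.* 2 ℕ.^ (e ℕ.* 6) ℕ.* q
    ≡⟨ cong (ℕ._* q) (ℕ.^-distribˡ-+-* 2 2 (e ℕ.* 6)) ⟨
  2 ℕ.^ (2 ℕ.+ e ℕ.* 6) ℕ.* q
    <⟨ ℕ.*-monoʳ-< (2 ℕ.^ (2 ℕ.+ e ℕ.* 6)) {{ℕ.m^n≢0 2 (2 ℕ.+ e ℕ.* 6)}} (n<2^n q) ⟩
  2 ℕ.^ (2 ℕ.+ e ℕ.* 6) ℕ.* 2 ℕ.^ q
    ≡⟨ ℕ.^-distribˡ-+-* 2 (2 ℕ.+ e ℕ.* 6) q ⟨
  2 ℕ.^ (2 ℕ.+ e ℕ.* 6 ℕ.+ q)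
    ≤⟨ ℕ.^-monoʳ-≤ 2 exponent≤k ⟩
  2 ℕ.^ k ∎
  where open ℕ.≤-Reasoning

-- Here `j` stands for k / 8, with `suc k ≤ 2 ^ (3 + j)`. The sixth power uses `6 j` of the
-- available `8 j`, and one further `j` absorbs `q` and the overhead 20 = 2 + 3 · 6.
exponent-bound : ∀ {q j} → 20 ℕ.+ q ≤ j → 2 ℕ.+ (3 ℕ.+ j) ℕ.* 6 ℕ.+ q ≤ j ℕ.* 8
exponent-bound {q} {j} j≥ = begin
  2 ℕ.+ (3 ℕ.+ j) ℕ.* 6 ℕ.+ q  ≡⟨ regroup j q ⟩
  (20 ℕ.+ q) ℕ.+ j ℕ.* 6       ≤⟨ ℕ.+-monoˡ-≤ (j ℕ.* 6) j≥ ⟩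
  j ℕ.+ j ℕ.* 6                ≤⟨ ℕ.m≤m+n (j ℕ.+ j ℕ.* 6) j ⟩
  j ℕ.+ j ℕ.* 6 ℕ.+ j          ≡⟨ eight j ⟩
  j ℕ.* 8                      ∎
  where
  open ℕ.≤-Reasoning
  regroup : ∀ j q → 2 ℕ.+ (3 ℕ.+ j) ℕ.* 6 ℕ.+ q ≡ (20 ℕ.+ q) ℕ.+ j ℕ.* 6
  regroup = ℕRing.solve-∀
  eight : ∀ j → j ℕ.+ j ℕ.* 6 ℕ.+ j ≡ j ℕ.* 8
  eight = ℕRing.solve-∀

suc≤2^ : ∀ k → suc k ≤ 2 ℕ.^ (3 ℕ.+ k ℕ./ 8)
suc≤2^ k = begin
  suc k                            ≡⟨ cong suc (ℕ.m≡m%n+[m/n]*n k 8) ⟩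
  suc (k ℕ.% 8) ℕ.+ k ℕ./ 8 ℕ.* 8  ≤⟨ ℕ.+-monoˡ-≤ (k ℕ./ 8 ℕ.* 8) (ℕ.m%n<n k 8) ⟩
  suc (k ℕ./ 8) ℕ.* 8              ≤⟨ ℕ.*-monoˡ-≤ 8 (n<2^n (k ℕ./ 8)) ⟩
  2 ℕ.^ (k ℕ./ 8) ℕ.* 8            ≡⟨ ℕ.*-comm (2 ℕ.^ (k ℕ./ 8)) 8 ⟩
  8 ℕ.* 2 ℕ.^ (k ℕ./ 8)            ≡⟨ ℕ.^-distribˡ-+-* 2 3 (k ℕ./ 8) ⟨
  2 ℕ.^ (3 ℕ.+ k ℕ./ 8)            ∎
  where open ℕ.≤-Reasoning

poly<2^ : ∀ q k → (20 ℕ.+ q) ℕ.* 8 ≤ k → 4 ℕ.* suc k ℕ.^ 6 ℕ.* q < 2 ℕ.^ k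
poly<2^ q k k≥ = poly<2^exponent {suc k} {3 ℕ.+ k ℕ./ 8} q (suc≤2^ k)
  (ℕ.≤-trans (exponent-bound {q} {k ℕ./ 8} j≥) (ℕ.m/n*n≤m k 8))
  where
  j≥ : 20 ℕ.+ q ≤ k ℕ./ 8
  j≥ = ℕ.≤-trans (ℕ.≤-reflexive (sym (ℕ.m*n/n≡m (20 ℕ.+ q) 8))) (ℕ./-monoˡ-≤ 8 k≥)

error→0 : TendsToZero error
error→0 (ℚ.mkℚ (+ zero) d _)    (ℚ.*<* (ℤ.+<+ ()))
error→0 (ℚ.mkℚ (ℤ.-[1+ n ]) d _) (ℚ.*<* ())
-- With `q = suc d` the threshold gives `error k < 1 / suc d`, which is at most δ because its
-- numerator is positive.
error→0 δ@(ℚ.mkℚ (+ suc n) d _) 0<δ = (20 ℕ.+ suc d) ℕ.* 8 , λ k k≥ →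
  subst₂ ℚ._<_ (sym (ℚ.0≤p⇒∣p∣≡p (0≤error k))) (ℚ.↥p/↧p≡p δ)
    (/-mono-< (4 ℕ.* suc k ℕ.^ 6) (suc n) (2 ℕ.^ k) (suc d) {{ℕ.m^n≢0 2 k}}
      (ℕ.<-≤-trans (poly<2^ (suc d) k k≥) (ℕ.m≤n*m (2 ℕ.^ k) (suc n))))
  where
  0≤error : ∀ k → ℚ.0ℚ ℚ.≤ error k
  0≤error k = ℚ.nonNegative⁻¹ (error k) {{ℚ.normalize-nonNeg (4 ℕ.* suc k ℕ.^ 6) (2 ℕ.^ k) {{ℕ.m^n≢0 2 k}}}}

poly≤error : ∀ k → ℕ→ℚ (2 ℕ.* suc k ℕ.^ 6 ℕ.* k) ℚ.≤ error k ℚ.* ℕ→ℚ k ℚ.* pow2-pred k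
poly≤error k = begin
  ℕ→ℚ (2 ℕ.* P ℕ.* k)
    ≤⟨ /-mono-≤ (2 ℕ.* P ℕ.* k) (4 ℕ.* P ℕ.* k ℕ.* 2 ℕ.^ k) 1 (2 ℕ.^ k ℕ.* 1 ℕ.* 2) {{_}} {{nz}}
         (ℕ.≤-reflexive (regroup P k (2 ℕ.^ k))) ⟩
  (+ (4 ℕ.* P ℕ.* k ℕ.* 2 ℕ.^ k) / (2 ℕ.^ k ℕ.* 1 ℕ.* 2)) {{nz}}
    ≡⟨ /-* (4 ℕ.* P ℕ.* k) (2 ℕ.^ k) (2 ℕ.^ k ℕ.* 1) 2 {{nz′}} ⟨
  (+ (4 ℕ.* P ℕ.* k) / (2 ℕ.^ k ℕ.* 1)) {{nz′}} ℚ.* pow2-pred k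
    ≡⟨ cong (ℚ._* pow2-pred k) (/-* (4 ℕ.* P) k (2 ℕ.^ k) 1 {{ℕ.m^n≢0 2 k}}) ⟨
  error k ℚ.* ℕ→ℚ k ℚ.* pow2-pred k ∎
  where
  open ℚ.≤-Reasoning
  P = suc k ℕ.^ 6
  nz′ : ℕ.NonZero (2 ℕ.^ k ℕ.* 1)
  nz′ = ℕ.m*n≢0 (2 ℕ.^ k) 1 {{ℕ.m^n≢0 2 k}}
  nz : ℕ.NonZero (2 ℕ.^ k ℕ.* 1 ℕ.* 2)
  nz = ℕ.m*n≢0 (2 ℕ.^ k ℕ.* 1) 2 {{nz′}}
  regroup : ∀ p k t → 2 ℕ.* p ℕ.* k ℕ.* (t ℕ.* 1 ℕ.* 2) ≡ 4 ℕ.* p ℕ.* k ℕ.* t ℕ.* 1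
  regroup = ℕRing.solve-∀

theorem1 : ∃ λ (ε : ℕ → ℚ) → TendsToZero ε ×
    (∀ n (f : BooleanFunction n) →
    (bs f ≤ C f) ×
    (ℕ→ℚ (C f) ℚ.≤ (+ 8 / 9 ℚ.+ ε (s f)) ℚ.* ℕ→ℚ (s f) ℚ.* pow2-pred (s f)))
theorem1 = error , error→0 , λ n f → bs≤C f , (begin
  ℕ→ℚ (C f)
    ≤⟨ /-mono-≤ (C f) (2 ℕ.* suc (s f) ℕ.^ 6 ℕ.* s f) 1 1 (ℕ.*-monoˡ-≤ 1 (C≤poly f)) ⟩
  ℕ→ℚ (2 ℕ.* suc (s f) ℕ.^ 6 ℕ.* s f)
    ≤⟨ poly≤error (s f) ⟩
  error (s f) ℚ.* ℕ→ℚ (s f) ℚ.* pow2-pred (s f)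
    ≤⟨ ℚ.*-monoʳ-≤-nonNeg (pow2-pred (s f)) {{ℚ.normalize-nonNeg (2 ℕ.^ s f) 2}}
         (ℚ.*-monoʳ-≤-nonNeg (ℕ→ℚ (s f)) {{ℚ.normalize-nonNeg (s f) 1}} (ε≤8/9+ε (error (s f)))) ⟩
  (+ 8 / 9 ℚ.+ error (s f)) ℚ.* ℕ→ℚ (s f) ℚ.* pow2-pred (s f) ∎)
  where
  open ℚ.≤-Reasoning
  ε≤8/9+ε : ∀ ε → ε ℚ.≤ + 8 / 9 ℚ.+ ε
  ε≤8/9+ε ε = subst (ℚ._≤ + 8 / 9 ℚ.+ ε) (ℚ.+-identityˡ ε)
    (ℚ.+-monoˡ-≤ ε (ℚ.nonNegative⁻¹ (+ 8 / 9)))
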